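{- For alphabet size $|\Sigma|=2$, LCS can be solved in time $O(n+\delta M/n)$. That is, there is an algorithm which, given any two strings $x,y$ over $\{0,1\}$ with $|x|\ge|y|$ and $|x|\ge1$, computes the length of a longest common subsequence of $x$ and $y$ in time $O(n+\delta M/n)$.
   Context: Here $n=|x|$, $m=|y|$, $L$ is the length of a longest common subsequence of $x$ and $y$, $\delta=m-L$, and $M=\#\{(i,j): 1\le i\le|x|,\ 1\le j\le|y|,\ x[i]=y[j]\}$ is the number of matching pairs. The model of computation is the standard word RAM with words of $\Theta(\log n)$ bits. -}

module Defs where

open import Data.Fin using (Fin; toℕ)
open import Data.Fin.Properties using () renaming (_≟_ to _≟ᶠ_)
open import Data.List using (List; []; _∷_; _++_; length; lookup; map; filter; allFin; cartesianProduct)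
open import Data.List.Relation.Binary.Sublist.Propositional using (_⊆_)
open import Data.Maybe using (Maybe; just; nothing)
open import Data.Nat
open import Data.Nat.DivMod using (_/_; _%_; _mod_)
open import Data.Nat.Logarithm using (⌊log₂_⌋)
open import Data.Nat.Properties using (m^n≢0)
open import Data.Product using (_×_; _,_; ∃-syntax)
open import Data.Vec.Functional using (Vector; updateAt)
open import Function using (const)
open import Relation.Binary.PropositionalEquality using (_≡_)
open import Relation.Nullary using (yes; no)

BinString : Set
BinString = List (Fin 2)

-- Here _⊆_ is the standard library's order-preserving sublist relation, i.e.
-- "is a (not necessarily contiguous) subsequence of".
CommonSubsequence : BinString → BinString → BinString → Set
CommonSubsequence x y z = z ⊆ x × z ⊆ y

LCSLength : BinString → BinString → ℕ → Set
LCSLength x y L =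
  (∃[ z ] (CommonSubsequence x y z × length z ≡ L)) ×
  (∀ z → CommonSubsequence x y z → length z ≤ L)

matchingPairs : (x y : BinString) → List (Fin (length x) × Fin (length y))
matchingPairs x y =
  filter (λ { (i , j) → lookup x i ≟ᶠ lookup y j })
         (cartesianProduct (allFin (length x)) (allFin (length y)))

#matchingPairs : BinString → BinString → ℕ
#matchingPairs x y = length (matchingPairs x y)

-- A word RAM with word length w: values and addresses are both w-bit words, so
-- the memory has 2 ^ w cells; a program uses a fixed number of registers, and
-- every instruction takes unit time.

Word : ℕ → Set
Word w = Fin (2 ^ w)

toWord : ∀ w → ℕ → Word w
toWord w k = _mod_ k (2 ^ w) {{m^n≢0 2 w}}

data BinOp : Set where
  add sub mul quo rem and or xor shl shr : BinOp

-- Division and remainder by 0 both yield 0.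
quotient remainder : ℕ → ℕ → ℕ
quotient  a zero        = 0
quotient  a b@(suc _)   = a / b
remainder a zero        = 0
remainder a b@(suc _)   = a % b

-- Applies a function on bits (arguments and result in {0,1}) to the w lowest
-- binary digits of two numbers.
bitwise : (ℕ → ℕ → ℕ) → ℕ → ℕ → ℕ → ℕ
bitwise f zero    a b = 0
bitwise f (suc w) a b = f (a % 2) (b % 2) + 2 * bitwise f w (a / 2) (b / 2)

-- Results are reduced modulo 2 ^ w by evalOp below; the summand 2 ^ w in sub
-- makes subtraction wrap around instead of truncating at 0.
evalOpℕ : ℕ → BinOp → ℕ → ℕ → ℕ
evalOpℕ w add a b = a + b
evalOpℕ w sub a b = (2 ^ w + a) ∸ b
evalOpℕ w mul a b = a * b
evalOpℕ w quo a b = quotient a b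
evalOpℕ w rem a b = remainder a b
evalOpℕ w and a b = bitwise _⊓_ w a b
evalOpℕ w or  a b = bitwise _⊔_ w a b
evalOpℕ w xor a b = bitwise ∣_-_∣ w a b
evalOpℕ w shl a b = a * 2 ^ b
evalOpℕ w shr a b = quotient a (2 ^ b)

evalOp : ∀ w → BinOp → Word w → Word w → Word w
evalOp w ⊙ a b = toWord w (evalOpℕ w ⊙ (toℕ a) (toℕ b))

-- `load d a` sets register d to the cell addressed by register a; `store a s`
-- sets the cell addressed by register a to register s. Jump targets are
-- absolute positions in the code.
data Instr (k : ℕ) : Set where
  loadConst : (d : Fin k) → ℕ → Instr k
  move      : (d s : Fin k) → Instr k
  op        : BinOp → (d a b : Fin k) → Instr k
  load      : (d a : Fin k) → Instr k
  store     : (a s : Fin k) → Instr k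
  jump      : ℕ → Instr k
  jumpIf≡   : (a b : Fin k) → ℕ → Instr k
  jumpIf<   : (a b : Fin k) → ℕ → Instr k

record Program : Set where
  field
    #registers : ℕ
    code       : List (Instr #registers)

open Program public

record Config (k w : ℕ) : Set where
  constructor config
  field
    pc        : ℕ
    registers : Vector (Word w) k
    memory    : Vector (Word w) (2 ^ w)

open Config public

exec : ∀ {k w} → Instr k → Config k w → Config k w
exec {w = w} (loadConst d n) (config p r m) =
  config (suc p) (updateAt r d (const (toWord w n))) m
exec (move d s)  (config p r m) = config (suc p) (updateAt r d (const (r s))) m
exec {w = w} (op ⊙ d a b) (config p r m) =
  config (suc p) (updateAt r d (const (evalOp w ⊙ (r a) (r b)))) m
exec (load d a)  (config p r m) = config (suc p) (updateAt r d (const (m (r a)))) m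
exec (store a s) (config p r m) = config (suc p) r (updateAt m (r a) (const (r s)))
exec (jump l)    (config p r m) = config l r m
exec (jumpIf≡ a b l) (config p r m) with toℕ (r a) ≟ toℕ (r b)
... | yes _ = config l r m
... | no  _ = config (suc p) r m
exec (jumpIf< a b l) (config p r m) with toℕ (r a) <? toℕ (r b)
... | yes _ = config l r m
... | no  _ = config (suc p) r m

fetch : ∀ {k} → List (Instr k) → ℕ → Maybe (Instr k)
fetch []       _       = nothing
fetch (i ∷ _)  zero    = just i
fetch (_ ∷ is) (suc p) = fetch is p

-- P ⊢ σ ⇓[ t ] τ: started in σ, the program P halts in τ after exactly t
-- instructions. The machine halts when the program counter leaves the code.
data _⊢_⇓[_]_ {w : ℕ} (P : Program) :
       Config (#registers P) w → ℕ → Config (#registers P) w → Set where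
  halted : ∀ {σ} → fetch (code P) (pc σ) ≡ nothing → P ⊢ σ ⇓[ 0 ] σ
  step   : ∀ {σ τ t i} → fetch (code P) (pc σ) ≡ just i →
           P ⊢ exec i σ ⇓[ t ] τ → P ⊢ σ ⇓[ suc t ] τ

-- Memory contents from address 0 on; all further cells hold 0.
cell : List ℕ → ℕ → ℕ
cell []       _       = 0
cell (v ∷ _)  zero    = v
cell (_ ∷ vs) (suc a) = cell vs a

-- The input occupies the cells 0, 1, 2, … in the order |x|, |y|, the symbols of
-- x, the symbols of y (one symbol per cell).
encodeInput : BinString → BinString → List ℕ
encodeInput x y = length x ∷ length y ∷ map toℕ x ++ map toℕ y

initial : ∀ (k w : ℕ) → BinString → BinString → Config k w
initial k w x y =
  config 0 (λ _ → toWord w 0) (λ a → toWord w (cell (encodeInput x y) (toℕ a)))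

-- On word length w and input x, y, the program P halts after exactly t steps
-- with the number v in memory cell 0.
Outputs : Program → (w : ℕ) → BinString → BinString → (t v : ℕ) → Set
Outputs P w x y t v =
  ∃[ τ ] (P ⊢ initial (#registers P) w x y ⇓[ t ] τ
          × toℕ (memory τ (toWord w 0)) ≡ v)

-- The number of bits of n (for n ≥ 1). Unlike log n it is nonzero at n = 1, so
-- it may serve as log n in Θ(log n) for all n ≥ 1.
bits : ℕ → ℕ
bits n = suc ⌊log₂ n ⌋

-- Let Z be the majority symbol of x, let O be the other one, and let p be the
-- number of Z's in y. Since x contains at least n/2 Z's, M ≥ p n / 2, so it
-- suffices to spend O(n + (p + 1)(δ + 1)) time.
--
-- Reading y from the right and deleting d of its symbols, let reach(d) be the
-- last position of x from which the rest of y can still be matched. For a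
-- suffix of y starting with Z this obeys the usual recurrence. A run of ℓ O's is
-- handled in one go: deleting e of them leads from reach(d - e) to the
-- (ℓ - e)-th O to its left, and the best choice minimises
-- (number of O's at or after reach(j)) + j over the window d - ℓ ≤ j ≤ d. These
-- keys grow by at most one with j, so a table of the latest occurrence of every
-- value yields all window minima in constant amortised time. Thus only p + 1
-- rows of columns 0, …, N - 1 are computed, with N doubled until N > δ.
module Submission where

open import Defs
open import Data.Bool using (Bool; true; false; if_then_else_; not; _∧_; _∨_; T)
open import Data.Bool.Properties using (T-∧; ∨-conicalˡ; ∨-conicalʳ; not-injective)
open import Data.Fin using (Fin; zero; suc; toℕ; #_)
open import Data.Fin.Properties using (toℕ-fromℕ<; toℕ-injective; toℕ<n) renaming (_≟_ to _≟ᶠ_)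
open import Data.List using (List; []; _∷_; _++_; length; drop; map; filter; lookup; replicate; allFin; cartesianProduct)
open import Data.List.Properties using (length-++; length-map; length-filter; filter-++; filter-accept; filter-reject; drop-drop; map-tabulate; tabulate-lookup; ++-identityʳ)
open import Data.List.Relation.Binary.Sublist.Propositional using (_⊆_; []; _∷_; _∷ʳ_; minimum; ⊆-trans; ⊆-refl)
open import Data.List.Relation.Binary.Sublist.Propositional.Properties using (length-mono-≤)
open import Data.List.Relation.Unary.All using (All; []; _∷_)
open import Data.Maybe using (just; nothing)
open import Data.Nat
open import Data.Nat.DivMod using (m<n⇒m%n≡m; [m+kn]%n≡m%n; [m+n]%n≡m%n)
open import Data.Nat.Logarithm using (⌊log₂⌋-mono-≤; ⌊log₂[2^n]⌋≡n)
open import Data.Nat.Properties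
open import Data.Nat.Tactic.RingSolver using (solve-∀)
open import Data.Product using (_×_; _,_; ∃-syntax; proj₁; proj₂)
open import Data.Sum using (inj₁; inj₂)
open import Data.Unit using (tt)
open import Data.Vec.Functional using (Vector; updateAt)
open import Data.Vec.Functional.Properties using (updateAt-updates; updateAt-minimal)
open import Function using (const)
open import Function.Bundles using (Equivalence)
open import Relation.Binary.PropositionalEquality
open import Relation.Nullary using (¬_; yes; no; contradiction)
open import Relation.Unary using (Decidable)


-- A structured language of programs, compiled to the word RAM

-- The target `O(n + (p + 1)(δ + 1))` suffices because `p` and `δ` are both at most `m ≤ n`: in the
-- expanded product only `p δ` can exceed linear time, and `p n ≤ 2 M` turns it into `2 δ M / n`.
-- The obstacle outside the algorithm is the machine: words wrap around, jump targets are absolute,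
-- and input and tables share one memory. The program is therefore written in a structured language
-- over natural numbers with arrays of unlimited extent, and a simulation transfers its runs to the
-- machine once and for all. Absence of overflow is not argued variable by variable. Apart from sums
-- of fixed depth, a value grows by at most one per instruction, so the running time bounds all
-- values and array indices. The time is at most quadratic in `n`, and hence words of `16 * bits n`
-- bits have room for everything.

data Basic (k a : ℕ) : Set where
  clear      : (d : Fin k) → Basic k a
  copy incr  : (d s : Fin k) → Basic k a
  plus minus : (d x y : Fin k) → Basic k a
  get        : (d : Fin k) (A : Fin a) (i : Fin k) → Basic k a
  put        : (A : Fin a) (i s : Fin k) → Basic k a

data Cond (k : ℕ) : Set where
  less equal : (x y : Fin k) → Cond k

infixr 5 _⨾_

data Cmd (k a : ℕ) : Set where
  basic : Basic k a → Cmd k a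
  read  : (d i : Fin k) → Cmd k a
  _⨾_   : Cmd k a → Cmd k a → Cmd k a
  cond  : Cond k → Cmd k a → Cmd k a → Cmd k a
  while : Cond k → Cmd k a → Cmd k a

record State (k a : ℕ) : Set where
  constructor state
  field
    reg : Vector ℕ k
    arr : Vector (ℕ → ℕ) a

open State public

infixl 8 _[_≔_]

_[_≔_] : (ℕ → ℕ) → ℕ → ℕ → ℕ → ℕ
(f [ i ≔ v ]) j = if i ≡ᵇ j then v else f j

set : ∀ {k} → Vector ℕ k → Fin k → ℕ → Vector ℕ k
set ρ d v = updateAt ρ d (const v)

eval : ∀ {k a} → Basic k a → State k a → State k a
eval (clear d)     (state ρ α) = state (set ρ d 0) α
eval (copy d s)    (state ρ α) = state (set ρ d (ρ s)) α
eval (incr d s)    (state ρ α) = state (set ρ d (suc (ρ s))) α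
eval (plus d x y)  (state ρ α) = state (set ρ d (ρ x + ρ y)) α
eval (minus d x y) (state ρ α) = state (set ρ d (ρ x ∸ ρ y)) α
eval (get d A i)   (state ρ α) = state (set ρ d (α A (ρ i))) α
eval (put A i s)   (state ρ α) = state ρ (updateAt α A (_[ ρ i ≔ ρ s ]))

Holds : ∀ {k a} → Cond k → State k a → Set
Holds (less x y) s = reg s x < reg s y
Holds (equal x y) s = reg s x ≡ reg s y

-- Reads beyond the input have no meaning: the arrays are laid out there.
data Run {k a} (inp : List ℕ) : Cmd k a → State k a → ℕ → State k a → Set where
  basic : ∀ {b s} → Run inp (basic b) s 1 (eval b s)
  read  : ∀ {d i s} → reg s i < length inp →
          Run inp (read d i) s 1 (state (set (reg s) d (cell inp (reg s i))) (arr s))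
  _⨾_   : ∀ {c c′ s s′ s″ t t′} → Run inp c s t s′ → Run inp c′ s′ t′ s″ →
          Run inp (c ⨾ c′) s (t + t′) s″
  ifTrue  : ∀ {b c c′ s s′ t} → Holds b s → Run inp c s t s′ →
          Run inp (cond b c c′) s (suc t) s′
  ifFalse : ∀ {b c c′ s s′ t} → ¬ Holds b s → Run inp c′ s t s′ →
          Run inp (cond b c c′) s (suc t) s′
  loop  : ∀ {b c s s′ s″ t t′} → Holds b s → Run inp c s t s′ →
          Run inp (while b c) s′ t′ s″ → Run inp (while b c) s (suc (t + t′)) s″
  exit  : ∀ {b c s} → ¬ Holds b s → Run inp (while b c) s 1 s

-- Growth of values along a run.

module Levels {k : ℕ} (level : Fin k → ℕ) where

  -- The value of a register r stays below 2 ^ level r times a bound that grows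
  -- by one per instruction. Sums go to a higher level and only level 0 is ever
  -- stored, so a short computation cannot overflow.
  levelledBasic : ∀ {a} → Basic k a → Bool
  levelledBasic (clear d)     = true
  levelledBasic (copy d s)    = level s ≤ᵇ level d
  levelledBasic (incr d s)    = level s ≤ᵇ level d
  levelledBasic (plus d x y)  = (level x <ᵇ level d) ∧ (level y <ᵇ level d)
  levelledBasic (minus d x y) = level x ≤ᵇ level d
  levelledBasic (get d A i)   = true
  levelledBasic (put A i s)   = level s ≤ᵇ 0

  levelled : ∀ {a} → Cmd k a → Bool
  levelled (basic b)     = levelledBasic b
  levelled (read d i)    = true
  levelled (c ⨾ c′)      = levelled c ∧ levelled c′
  levelled (cond b c c′) = levelled c ∧ levelled c′
  levelled (while b c)   = levelled c

  record Bounded {a} (V : ℕ) (s : State k a) : Set where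
    constructor bounded
    field
      reg≤ : ∀ r → reg s r ≤ 2 ^ level r * V
      arr≤ : ∀ A i → arr s A i ≤ V

  private
    scale : ∀ l V → V ≤ 2 ^ l * V
    scale l V = subst (_≤ 2 ^ l * V) (*-identityˡ V) (*-monoˡ-≤ V (m^n>0 2 l))

    scale-mono : ∀ l l′ V → l ≤ l′ → 2 ^ l * V ≤ 2 ^ l′ * V
    scale-mono l l′ V l≤l′ = *-monoˡ-≤ V (^-monoʳ-≤ 2 l≤l′)

    scale-suc : ∀ l V → suc (2 ^ l * V) ≤ 2 ^ l * suc V
    scale-suc l V = subst (suc (2 ^ l * V) ≤_) (sym (*-suc (2 ^ l) V))
                      (+-monoˡ-≤ (2 ^ l * V) (m^n>0 2 l))

    set-bounded : ∀ {V} {ρ : Vector ℕ k} d {v} → v ≤ 2 ^ level d * suc V →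
                  (∀ r → ρ r ≤ 2 ^ level r * V) → ∀ r → set ρ d v r ≤ 2 ^ level r * suc V
    set-bounded {V} {ρ} d {v} v≤ ρ≤ r with r ≟ᶠ d
    ... | yes refl = subst (_≤ 2 ^ level r * suc V) (sym (updateAt-updates r ρ)) v≤
    ... | no r≢d = subst (_≤ 2 ^ level r * suc V) (sym (updateAt-minimal r d ρ r≢d))
                     (≤-trans (ρ≤ r) (*-monoʳ-≤ (2 ^ level r) (n≤1+n V)))

    store-bounded : ∀ {V} (f : ℕ → ℕ) i {v} → v ≤ V → (∀ j → f j ≤ V) → ∀ j → (f [ i ≔ v ]) j ≤ V
    store-bounded f i v≤ f≤ j with i ≡ᵇ j
    ... | true  = v≤
    ... | false = f≤ j

  eval-bounded : ∀ {a V} (b : Basic k a) {s} → T (levelledBasic b) →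
                 Bounded V s → Bounded (suc V) (eval b s)
  eval-bounded (clear d) _ (bounded ρ≤ α≤) =
    bounded (set-bounded d z≤n ρ≤) λ A i → m≤n⇒m≤1+n (α≤ A i)
  eval-bounded {V = V} (copy d s) ok (bounded ρ≤ α≤) =
    bounded (set-bounded d (≤-trans (ρ≤ s) (≤-trans (scale-mono (level s) (level d) V (≤ᵇ⇒≤ (level s) (level d) ok)) (*-monoʳ-≤ (2 ^ level d) (n≤1+n V)))) ρ≤)
    λ A i → m≤n⇒m≤1+n (α≤ A i)
  eval-bounded {V = V} (incr d s) ok (bounded ρ≤ α≤) =
    bounded (set-bounded d (≤-trans (s≤s (≤-trans (ρ≤ s) (scale-mono (level s) (level d) V (≤ᵇ⇒≤ (level s) (level d) ok)))) (scale-suc (level d) V)) ρ≤)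
    λ A i → m≤n⇒m≤1+n (α≤ A i)
  eval-bounded {V = V} (plus d x y) {s} ok (bounded ρ≤ α≤) =
    bounded (set-bounded d sum≤ ρ≤) λ A i → m≤n⇒m≤1+n (α≤ A i)
    where
    ok× = Equivalence.to T-∧ ok
    -- Each summand lies at a strictly lower level, so it is at most half of the bound at the level
    -- of `d`. Doubling everything avoids the predecessor of that level.
    half : ∀ {z} → level z < level d → 2 * reg s z ≤ 2 ^ level d * V
    half {z} z<d = ≤-trans (*-monoʳ-≤ 2 (ρ≤ z))
      (≤-trans (≤-reflexive (sym (*-assoc 2 (2 ^ level z) V))) (scale-mono _ (level d) V z<d))
    sum≤ : reg s x + reg s y ≤ 2 ^ level d * suc V
    sum≤ = *-cancelˡ-≤ 2 (≤-trans (≤-reflexive (*-distribˡ-+ 2 (reg s x) (reg s y)))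
      (≤-trans (+-mono-≤ (half (<ᵇ⇒< _ _ (proj₁ ok×))) (half (<ᵇ⇒< _ _ (proj₂ ok×))))
      (≤-trans (≤-reflexive (cong (2 ^ level d * V +_) (sym (+-identityʳ _))))
               (*-monoʳ-≤ 2 (*-monoʳ-≤ (2 ^ level d) (n≤1+n V))))))
  eval-bounded {V = V} (minus d x y) {s} ok (bounded ρ≤ α≤) =
    bounded (set-bounded d (≤-trans (m∸n≤m (reg s x) (reg s y))
      (≤-trans (ρ≤ x) (≤-trans (scale-mono (level x) (level d) V (≤ᵇ⇒≤ (level x) (level d) ok)) (*-monoʳ-≤ (2 ^ level d) (n≤1+n V))))) ρ≤)
    λ A i → m≤n⇒m≤1+n (α≤ A i)
  eval-bounded {V = V} (get d A i) {s} ok (bounded ρ≤ α≤) =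
    bounded (set-bounded d (≤-trans (m≤n⇒m≤1+n (α≤ A (reg s i))) (scale (level d) (suc V))) ρ≤)
    λ A i → m≤n⇒m≤1+n (α≤ A i)
  eval-bounded {V = V} (put A i s) {state ρ α} ok (bounded ρ≤ α≤) =
    bounded (λ r → ≤-trans (ρ≤ r) (*-monoʳ-≤ (2 ^ level r) (n≤1+n V))) stored
    where
    ρs≤V : ρ s ≤ V
    ρs≤V = ≤-trans (ρ≤ s) (≤-trans (scale-mono (level s) 0 V (≤ᵇ⇒≤ (level s) 0 ok)) (≤-reflexive (*-identityˡ V)))
    stored : ∀ B j → updateAt α A (_[ ρ i ≔ ρ s ]) B j ≤ suc V
    stored B j with B ≟ᶠ A
    ... | yes refl = subst (λ f → f j ≤ suc V) (sym (updateAt-updates A α))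
                       (m≤n⇒m≤1+n (store-bounded (α A) (ρ i) ρs≤V (α≤ A) j))
    ... | no B≢A = subst (λ f → f j ≤ suc V) (sym (updateAt-minimal B A α B≢A)) (m≤n⇒m≤1+n (α≤ B j))

  Bounded-mono : ∀ {a V V′} {s : State k a} → V ≤ V′ → Bounded V s → Bounded V′ s
  Bounded-mono V≤V′ (bounded ρ≤ α≤) =
    bounded (λ r → ≤-trans (ρ≤ r) (*-monoʳ-≤ (2 ^ level r) V≤V′)) λ A i → ≤-trans (α≤ A i) V≤V′

  -- Time is charged to the bound: a command of cost `t` raises it by at most `t`. The bound on the
  -- input enters because a read may import any input number.
  run-bounded : ∀ {a inp V t} {c : Cmd k a} {s s′} → Run inp c s t s′ → T (levelled c) →
                (∀ i → cell inp i ≤ V) → Bounded V s → Bounded (V + t) s′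
  run-bounded {V = V} (basic {b} {s}) ok inp≤ bd =
    Bounded-mono (≤-reflexive (+-comm 1 V)) (eval-bounded b ok bd)
  run-bounded {V = V} (read {d} {i} {s} _) ok inp≤ (bounded ρ≤ α≤) =
    Bounded-mono (≤-reflexive (+-comm 1 V))
      (bounded (set-bounded d (≤-trans (m≤n⇒m≤1+n (inp≤ (reg s i))) (scale (level d) (suc V))) ρ≤)
       λ A i → m≤n⇒m≤1+n (α≤ A i))
  run-bounded {V = V} {c = c₁ ⨾ c₂} (_⨾_ {t = t} {t′} r r′) ok inp≤ bd =
    Bounded-mono (≤-reflexive (+-assoc V t t′))
      (run-bounded r′ (proj₂ oks) (λ i → ≤-trans (inp≤ i) (m≤m+n V t)) (run-bounded r (proj₁ oks) inp≤ bd))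
    where oks = Equivalence.to (T-∧ {levelled c₁}) ok
  run-bounded {V = V} {c = cond _ c₁ c₂} (ifTrue {t = t} _ r) ok inp≤ bd =
    Bounded-mono (+-monoʳ-≤ V (n≤1+n t)) (run-bounded r (proj₁ (Equivalence.to (T-∧ {levelled c₁}) ok)) inp≤ bd)
  run-bounded {V = V} {c = cond _ c₁ c₂} (ifFalse {t = t} _ r) ok inp≤ bd =
    Bounded-mono (+-monoʳ-≤ V (n≤1+n t)) (run-bounded r (proj₂ (Equivalence.to (T-∧ {levelled c₁}) ok)) inp≤ bd)
  run-bounded {V = V} (loop {t = t} {t′} _ r r′) ok inp≤ bd =
    Bounded-mono (≤-trans (≤-reflexive (+-assoc V t t′)) (+-monoʳ-≤ V (n≤1+n (t + t′))))
      (run-bounded r′ ok (λ i → ≤-trans (inp≤ i) (m≤m+n V t)) (run-bounded r ok inp≤ bd))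
  run-bounded {V = V} (exit _) ok inp≤ bd = Bounded-mono (m≤m+n V 1) bd

-- Translation into machine code.

data At {k} (P : List (Instr k)) : ℕ → List (Instr k) → Set where
  []  : ∀ {q} → At P q []
  _∷_ : ∀ {q i is} → fetch P q ≡ just i → At P (suc q) is → At P q (i ∷ is)

At-++ : ∀ {k} {P : List (Instr k)} {q} is {js} → At P q (is ++ js) → At P q is × At P (length is + q) js
At-++ []       at       = [] , at
At-++ {P = P} {q} (i ∷ is) {js} (f ∷ at) with At-++ is at
... | at₁ , at₂ = (f ∷ at₁) , subst (λ p → At P p js) (+-suc (length is) q) at₂

At-∷ : ∀ {k} {i : Instr k} {P q is} → At P q is → At (i ∷ P) (suc q) is
At-∷ []       = []
At-∷ (f ∷ at) = f ∷ At-∷ at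

At-offset : ∀ {k} (is js : List (Instr k)) → At (is ++ js) (length is) js
At-offset (i ∷ is) js       = At-∷ (At-offset is js)
At-offset []       []       = []
At-offset []       (j ∷ js) = refl ∷ At-∷ (At-offset [] js)

-- Registers 0 and 1 of the word RAM are scratch, register 2 holds the address
-- at which the arrays start; entry i of array A is stored i * a + A cells later.
pattern ⇑ r = suc (suc (suc r))
pattern scratch₀ = zero
pattern scratch₁ = suc zero
pattern origin = suc (suc zero)

compileBasic : ∀ {k a} → Basic k a → ℕ → List (Instr (3 + k))
compileBasic (clear d)    q = loadConst (⇑ d) 0 ∷ []
compileBasic (copy d s)   q = move (⇑ d) (⇑ s) ∷ []
compileBasic (incr d s)   q = loadConst scratch₀ 1 ∷ op add (⇑ d) (⇑ s) scratch₀ ∷ []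
compileBasic (plus d x y) q = op add (⇑ d) (⇑ x) (⇑ y) ∷ []
-- Machine subtraction wraps around whereas `minus` truncates, so the case `x < y` is branched off
-- to a constant 0.
compileBasic (minus d x y) q =
  jumpIf< (⇑ x) (⇑ y) (3 + q) ∷ op sub (⇑ d) (⇑ x) (⇑ y) ∷ jump (4 + q) ∷ loadConst (⇑ d) 0 ∷ []
compileBasic {a = a} (get d A i) q =
  loadConst scratch₀ a ∷ op mul scratch₀ (⇑ i) scratch₀ ∷ loadConst scratch₁ (toℕ A) ∷
  op add scratch₀ scratch₀ scratch₁ ∷ op add scratch₀ scratch₀ origin ∷ load (⇑ d) scratch₀ ∷ []
compileBasic {a = a} (put A i s) q =
  loadConst scratch₀ a ∷ op mul scratch₀ (⇑ i) scratch₀ ∷ loadConst scratch₁ (toℕ A) ∷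
  op add scratch₀ scratch₀ scratch₁ ∷ op add scratch₀ scratch₀ origin ∷ store scratch₀ (⇑ s) ∷ []

branch : ∀ {k} → Cond k → ℕ → Instr (3 + k)
branch (less x y) l = jumpIf< (⇑ x) (⇑ y) l
branch (equal x y) l = jumpIf≡ (⇑ x) (⇑ y) l

endBasic : ∀ {k a} → Basic k a → ℕ → ℕ
endBasic (clear _)     q = 1 + q
endBasic (copy _ _)    q = 1 + q
endBasic (incr _ _)    q = 2 + q
endBasic (plus _ _ _)  q = 1 + q
endBasic (minus _ _ _) q = 4 + q
endBasic (get _ _ _)   q = 6 + q
endBasic (put _ _ _)   q = 6 + q

-- Computed from the command and not from its code, so that forward jumps can be emitted before the
-- code they skip; `length-compile` shows that both agree.
end : ∀ {k a} → Cmd k a → ℕ → ℕ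
end (basic b)     q = endBasic b q
end (read d i)    q = 1 + q
end (c ⨾ c′)      q = end c′ (end c q)
end (cond _ c c′) q = end c (1 + end c′ (1 + q))
end (while _ c)   q = 1 + end c (2 + q)

compile : ∀ {k a} → Cmd k a → ℕ → List (Instr (3 + k))
compile (basic b)     q = compileBasic b q
compile (read d i)    q = load (⇑ d) (⇑ i) ∷ []
compile (c ⨾ c′)      q = compile c q ++ compile c′ (end c q)
-- The branch jumps when its condition holds, so the code of the second alternative comes first.
compile (cond b c c′) q =
  branch b (1 + end c′ (1 + q)) ∷ compile c′ (1 + q) ++
  jump (end c (1 + end c′ (1 + q))) ∷ compile c (1 + end c′ (1 + q))
-- No instruction jumps on a false condition; instead a true one skips over the jump that leaves the
-- loop.
compile (while b c)   q =
  branch b (2 + q) ∷ jump (1 + end c (2 + q)) ∷ compile c (2 + q) ++ jump q ∷ []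

length-compile : ∀ {k a} (c : Cmd k a) q → length (compile c q) + q ≡ end c q
length-compile (basic (clear _))     q = refl
length-compile (basic (copy _ _))    q = refl
length-compile (basic (incr _ _))    q = refl
length-compile (basic (plus _ _ _))  q = refl
length-compile (basic (minus _ _ _)) q = refl
length-compile (basic (get _ _ _))   q = refl
length-compile (basic (put _ _ _))   q = refl
length-compile (read _ _)            q = refl
length-compile (c ⨾ c′) q = begin
  length (compile c q ++ compile c′ (end c q)) + q          ≡⟨ cong (_+ q) (length-++ (compile c q)) ⟩
  length (compile c q) + length (compile c′ (end c q)) + q  ≡⟨ cong (_+ q) (+-comm (length (compile c q)) _) ⟩
  length (compile c′ (end c q)) + length (compile c q) + q  ≡⟨ +-assoc _ (length (compile c q)) q ⟩
  length (compile c′ (end c q)) + (length (compile c q) + q) ≡⟨ cong (length (compile c′ (end c q)) +_) (length-compile c q) ⟩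
  length (compile c′ (end c q)) + end c q                   ≡⟨ length-compile c′ (end c q) ⟩
  end c′ (end c q) ∎
  where open ≡-Reasoning
length-compile (cond b c c′) q = begin
  suc (length (C′ ++ j ∷ C)) + q   ≡⟨ cong (λ l → suc l + q) (length-++ C′) ⟩
  suc (length C′ + suc (length C)) + q ≡⟨ cong (λ l → suc l + q) (+-comm (length C′) _) ⟩
  suc (suc (length C) + length C′) + q ≡⟨ cong (2 +_) (+-assoc (length C) (length C′) q) ⟩
  2 + (length C + (length C′ + q)) ≡⟨ cong (1 +_) (+-suc (length C) _) ⟨
  1 + (length C + (1 + (length C′ + q))) ≡⟨ +-suc (length C) _ ⟨
  length C + (2 + (length C′ + q)) ≡⟨ cong (λ l → length C + suc l) (+-suc (length C′) q) ⟨
  length C + (1 + (length C′ + (1 + q))) ≡⟨ cong (λ l → length C + suc l) (length-compile c′ (1 + q)) ⟩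
  length C + (1 + end c′ (1 + q)) ≡⟨ length-compile c _ ⟩
  end c (1 + end c′ (1 + q)) ∎
  where
  open ≡-Reasoning
  C = compile c (1 + end c′ (1 + q))
  C′ = compile c′ (1 + q)
  j = jump (end c (1 + end c′ (1 + q)))
length-compile (while b c) q = begin
  2 + length (C ++ jump q ∷ []) + q ≡⟨ cong (λ l → 2 + l + q) (length-++ C) ⟩
  2 + (length C + 1) + q ≡⟨ cong (λ l → 2 + l + q) (+-comm (length C) 1) ⟩
  3 + (length C + q) ≡⟨ cong (2 +_) (+-suc (length C) q) ⟨
  2 + (length C + (1 + q)) ≡⟨ cong (1 +_) (+-suc (length C) (1 + q)) ⟨
  1 + (length C + (2 + q)) ≡⟨ cong suc (length-compile c (2 + q)) ⟩
  1 + end c (2 + q) ∎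
  where
  open ≡-Reasoning
  C = compile c (2 + q)

At-compile : ∀ {k a P q} (c : Cmd k a) {js} → At P q (compile c q ++ js) →
             At P q (compile c q) × At P (end c q) js
At-compile {P = P} {q} c {js} at with At-++ (compile c q) at
... | at₁ , at₂ = at₁ , subst (λ p → At P p js) (length-compile c q) at₂

-- Simulation of structured runs on the machine.

toℕ-toWord : ∀ w {v} → v < 2 ^ w → toℕ (toWord w v) ≡ v
toℕ-toWord w v< = trans (toℕ-fromℕ< _) (m<n⇒m%n≡m {{m^n≢0 2 w}} v<)

toWord-toℕ : ∀ w (u : Word w) {v} → toℕ u ≡ v → u ≡ toWord w v
toWord-toℕ w u refl = toℕ-injective (sym (toℕ-toWord w (toℕ<n u)))

address : ∀ {a} → ℕ → Fin a → ℕ → ℕ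
address {a} off A i = i * a + toℕ A + off

-- The residue modulo `a` recovers the array, the quotient the index. Because the arrays are
-- interleaved in this way, no array needs a length fixed in advance.
address-injective : ∀ {a} off (A B : Fin a) i j → address off A i ≡ address off B j → A ≡ B × i ≡ j
address-injective {suc a} off A B i j e = toℕ-injective A≡B , *-cancelʳ-≡ i j (suc a) ia≡ja
  where
  e′ : i * suc a + toℕ A ≡ j * suc a + toℕ B
  e′ = +-cancelʳ-≡ off _ _ e
  residue : ∀ i (A : Fin (suc a)) → (i * suc a + toℕ A) % suc a ≡ toℕ A
  residue i A = trans (cong (_% suc a) (+-comm (i * suc a) (toℕ A)))
    (trans ([m+kn]%n≡m%n (toℕ A) i (suc a)) (m<n⇒m%n≡m (toℕ<n A)))
  A≡B : toℕ A ≡ toℕ B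
  A≡B = trans (sym (residue i A)) (trans (cong (_% suc a) e′) (residue j B))
  ia≡ja : i * suc a ≡ j * suc a
  ia≡ja = +-cancelʳ-≡ (toℕ A) _ _ (trans e′ (cong (j * suc a +_) (sym A≡B)))

toℕ-updateAt : ∀ {k n} (r : Vector (Fin n) k) (ρ : Vector ℕ k) d {v v′} → toℕ v ≡ v′ →
               (∀ i → toℕ (r i) ≡ ρ i) → ∀ i → toℕ (updateAt r d (const v) i) ≡ set ρ d v′ i
toℕ-updateAt r ρ zero    v≡ r≡ zero    = v≡
toℕ-updateAt r ρ zero    v≡ r≡ (suc i) = r≡ (suc i)
toℕ-updateAt r ρ (suc d) v≡ r≡ zero    = r≡ zero
toℕ-updateAt r ρ (suc d) v≡ r≡ (suc i) =
  toℕ-updateAt (λ j → r (suc j)) (λ j → ρ (suc j)) d v≡ (λ j → r≡ (suc j)) i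

[≔]-same : ∀ f i v → (f [ i ≔ v ]) i ≡ v
[≔]-same f i v with i ≡ᵇ i in e
... | true  = refl
... | false = contradiction (≡⇒≡ᵇ i i refl) (subst (λ b → ¬ T b) (sym e) λ ())

[≔]-other : ∀ f i v j → i ≢ j → (f [ i ≔ v ]) j ≡ f j
[≔]-other f i v j i≢j with i ≡ᵇ j in e
... | true  = contradiction (≡ᵇ⇒≡ i j (subst T (sym e) tt)) i≢j
... | false = refl

-- `U` is to bound the initial values plus the running time, and `X` every register value. Array
-- indices are register values, so `room` need only provide addresses up to index `X`.
module Simulation {k a : ℕ} (level : Fin k → ℕ) (w : ℕ) (program : List (Instr (3 + k)))
                  (inp : List ℕ) (off X U : ℕ)
                  (inp≤off : length inp ≤ off) (X<2^w : suc X < 2 ^ w)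
                  (room : X * a + (a + off) < 2 ^ w)
                  (level≤ : ∀ r → 2 ^ level r * U ≤ X) where

  open Levels level

  P : Program
  P = record { #registers = 3 + k ; code = program }

  infix 4 _⇒[_]_

  -- The execution relation describes only runs that end in a halt. A segment of `t` steps is
  -- therefore expressed by what it does to every halting continuation, and segments compose as
  -- functions.
  _⇒[_]_ : Config (3 + k) w → ℕ → Config (3 + k) w → Set
  σ ⇒[ t ] σ′ = ∀ {u τ} → P ⊢ σ′ ⇓[ u ] τ → P ⊢ σ ⇓[ t + u ] τ

  ⇒-trans : ∀ {σ σ′ σ″ t t′} → σ ⇒[ t ] σ′ → σ′ ⇒[ t′ ] σ″ → σ ⇒[ t + t′ ] σ″
  ⇒-trans {σ} {t = t} {t′} p q {u} {τ} h = subst (λ v → P ⊢ σ ⇓[ v ] τ) (sym (+-assoc t t′ u)) (p (q h))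

  -- Arrays are total functions on all indices, so they are compared with the memory only where an
  -- address exists. The input stays readable throughout, as all arrays lie behind it.
  record Sim (s : State k a) (r : Vector (Word w) (3 + k)) (m : Vector (Word w) (2 ^ w)) : Set where
    field
      registers : ∀ i → toℕ (r (⇑ i)) ≡ reg s i
      base      : toℕ (r origin) ≡ off
      input     : ∀ i → i < length inp → toℕ (m (toWord w i)) ≡ cell inp i
      arrays    : ∀ A i → address off A i < 2 ^ w → toℕ (m (toWord w (address off A i))) ≡ arr s A i

  open Sim

  private
    <2^w : ∀ {v} → v ≤ X → v < 2 ^ w
    <2^w v≤ = ≤-<-trans (m≤n⇒m≤1+n v≤) X<2^w

    address< : ∀ A {i} → i ≤ X → address off A i < 2 ^ w
    address< A {i} i≤ = ≤-<-trans (≤-trans (≤-reflexive (+-assoc (i * a) (toℕ A) off))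
      (+-mono-≤ (*-monoˡ-≤ a i≤) (+-monoˡ-≤ off (<⇒≤ (toℕ<n A))))) room

    off≤address : ∀ (A : Fin a) i → off ≤ address off A i
    off≤address A i = m≤n+m off _

    -- A write disturbs only its own cell: array addresses start at `off`, past the input, and are
    -- injective. Injectivity survives the passage to words since the addresses compared fit into a
    -- word.
    store-sim : ∀ {s r m A i p v v′} → Sim s r m → i ≤ X → p ≡ toWord w (address off A i) → toℕ v ≡ v′ →
                Sim (state (reg s) (updateAt (arr s) A (_[ i ≔ v′ ]))) r (updateAt m p (const v))
    store-sim {s} {r} {m} {A} {i} {_} {v} {v′} S i≤ refl v≡ = record
      { registers = registers S
      ; base = base S
      ; input = λ j j< → trans (cong toℕ (updateAt-minimal _ _ m (λ e → <⇒≢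
          (<-≤-trans j< (≤-trans inp≤off (off≤address A i)))
          (word-injective (<-trans (<-≤-trans j< (≤-trans inp≤off (off≤address A i))) (address< A i≤))
                          (address< A i≤) e)))) (input S j j<)
      ; arrays = stored
      }
      where
      word-injective : ∀ {u u′} → u < 2 ^ w → u′ < 2 ^ w → toWord w u ≡ toWord w u′ → u ≡ u′
      word-injective u< u′< e = trans (sym (toℕ-toWord w u<)) (trans (cong toℕ e) (toℕ-toWord w u′<))
      stored : ∀ B j → address off B j < 2 ^ w →
               toℕ (updateAt m (toWord w (address off A i)) (const v) (toWord w (address off B j))) ≡
               updateAt (arr s) A (_[ i ≔ v′ ]) B j
      stored B j B< with B ≟ᶠ A
      ... | no B≢A =
        trans (cong toℕ (updateAt-minimal _ _ m λ e →
                B≢A (proj₁ (address-injective off B A j i (word-injective B< (address< A i≤) e)))))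
        (trans (arrays S B j B<) (cong (λ f → f j) (sym (updateAt-minimal B A (arr s) B≢A))))
      ... | yes refl with i ≟ j
      ...   | yes refl =
        trans (cong toℕ (updateAt-updates (toWord w (address off A i)) m))
        (trans v≡ (sym (trans (cong (λ f → f i) (updateAt-updates A (arr s))) ([≔]-same (arr s A) i v′))))
      ...   | no i≢j =
        trans (cong toℕ (updateAt-minimal _ _ m λ e →
                i≢j (sym (proj₂ (address-injective off A A j i (word-injective B< (address< A i≤) e))))))
        (trans (arrays S A j B<)
          (sym (trans (cong (λ f → f j) (updateAt-updates A (arr s))) ([≔]-other (arr s A) i v′ j i≢j))))

    set-sim : ∀ {s r m d v v′} → Sim s r m → toℕ v ≡ v′ →
              Sim (state (set (reg s) d v′) (arr s)) (updateAt r (⇑ d) (const v)) m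
    set-sim {s} {r} {d = d} S v≡ = record
      { registers = toℕ-updateAt (λ i → r (⇑ i)) (reg s) d v≡ (registers S)
      ; base = base S ; input = input S ; arrays = arrays S }

    scratch-sim : ∀ {s r r′ m} → Sim s r m → (∀ i → r′ (⇑ i) ≡ r (⇑ i)) → r′ origin ≡ r origin → Sim s r′ m
    scratch-sim S e e′ = record
      { registers = λ i → trans (cong toℕ (e i)) (registers S i)
      ; base = trans (cong toℕ e′) (base S) ; input = input S ; arrays = arrays S }

    -- Every partial result is at most the final address, so none of them wraps around.
    toℕ-address : ∀ {s r m} → Sim s r m → ∀ A {i} → reg s i ≤ X →
      toℕ (evalOp w add (evalOp w add (evalOp w mul (r (⇑ i)) (toWord w a)) (toWord w (toℕ A))) (r origin)) ≡
      address off A (reg s i)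
    toℕ-address {s} S A {i} i≤ = total
      where
      i< = address< A i≤
      a+off< : a + off < 2 ^ w
      a+off< = ≤-<-trans (m≤n+m (a + off) (X * a)) room
      product-eq = cong₂ _*_ (registers S i) (toℕ-toWord w (≤-<-trans (m≤m+n a off) a+off<))
      product = trans (toℕ-toWord w (subst (_< 2 ^ w) (sym product-eq)
        (≤-<-trans (≤-trans (m≤m+n _ (toℕ A)) (m≤m+n _ off)) i<))) product-eq
      sum-eq = cong₂ _+_ product (toℕ-toWord w (≤-<-trans (≤-trans (<⇒≤ (toℕ<n A)) (m≤m+n a off)) a+off<))
      sum = trans (toℕ-toWord w (subst (_< 2 ^ w) (sym sum-eq) (≤-<-trans (m≤m+n _ off) i<))) sum-eq
      total-eq = cong₂ _+_ sum (base S)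
      total = trans (toℕ-toWord w (subst (_< 2 ^ w) (sym total-eq) i<)) total-eq

  jump<-taken : ∀ {q r m} {x y : Fin (3 + k)} {l} → toℕ (r x) < toℕ (r y) →
                exec {w = w} (jumpIf< x y l) (config q r m) ≡ config l r m
  jump<-taken {r = r} {x = x} {y} x<y with toℕ (r x) <? toℕ (r y)
  ... | yes _ = refl
  ... | no x≮y = contradiction x<y x≮y

  jump<-skipped : ∀ {q r m} {x y : Fin (3 + k)} {l} → ¬ (toℕ (r x) < toℕ (r y)) →
                  exec {w = w} (jumpIf< x y l) (config q r m) ≡ config (suc q) r m
  jump<-skipped {r = r} {x = x} {y} x≮y with toℕ (r x) <? toℕ (r y)
  ... | yes x<y = contradiction x<y x≮y
  ... | no _ = refl

  jump≡-taken : ∀ {q r m} {x y : Fin (3 + k)} {l} → toℕ (r x) ≡ toℕ (r y) →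
                exec {w = w} (jumpIf≡ x y l) (config q r m) ≡ config l r m
  jump≡-taken {r = r} {x = x} {y} x≡y with toℕ (r x) ≟ toℕ (r y)
  ... | yes _ = refl
  ... | no x≢y = contradiction x≡y x≢y

  jump≡-skipped : ∀ {q r m} {x y : Fin (3 + k)} {l} → toℕ (r x) ≢ toℕ (r y) →
                  exec {w = w} (jumpIf≡ x y l) (config q r m) ≡ config (suc q) r m
  jump≡-skipped {r = r} {x = x} {y} x≢y with toℕ (r x) ≟ toℕ (r y)
  ... | yes x≡y = contradiction x≡y x≢y
  ... | no _ = refl

  step≡ : ∀ {σ σ′ τ : Config (3 + k) w} {t i} → fetch program (pc σ) ≡ just i → exec i σ ≡ σ′ →
          P ⊢ σ′ ⇓[ t ] τ → P ⊢ σ ⇓[ suc t ] τ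
  step≡ f refl h = step f h

  branch-taken : ∀ {b l q s r m} → Sim s r m → fetch program q ≡ just (branch b l) → Holds b s →
                 config q r m ⇒[ 1 ] config l r m
  branch-taken {less x y} S f x<y =
    step≡ f (jump<-taken (subst₂ _<_ (sym (registers S x)) (sym (registers S y)) x<y))
  branch-taken {equal x y} S f x≡y =
    step≡ f (jump≡-taken (trans (registers S x) (trans x≡y (sym (registers S y)))))

  branch-skipped : ∀ {b l q s r m} → Sim s r m → fetch program q ≡ just (branch b l) → ¬ Holds b s →
                   config q r m ⇒[ 1 ] config (suc q) r m
  branch-skipped {less x y} S f x≮y =
    step≡ f (jump<-skipped λ h → x≮y (subst₂ _<_ (registers S x) (registers S y) h))
  branch-skipped {equal x y} S f x≢y =
    step≡ f (jump≡-skipped λ h → x≢y (trans (sym (registers S x)) (trans h (registers S y))))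

  Simulates : ℕ → ℕ → ℕ → State k a → Vector (Word w) (3 + k) → Vector (Word w) (2 ^ w) → Set
  Simulates q q′ t s′ r m = ∃[ t′ ] ∃[ r′ ] ∃[ m′ ]
    (t′ ≤ t × Sim s′ r′ m′ × (config q r m ⇒[ t′ ] config q′ r′ m′))

  -- The 6 is the length of an array access, the longest execution of a basic command. That the
  -- resulting values are at most `X` keeps sums and increments from wrapping.
  simulate-basic : ∀ (b : Basic k a) {q s r m} → (∀ i → reg s i ≤ X) → (∀ i → reg (eval b s) i ≤ X) →
                   At program q (compileBasic b q) → Sim s r m →
                   Simulates q (endBasic b q) 6 (eval b s) r m
  simulate-basic (clear d) s≤ s′≤ (f₀ ∷ _) S =
    1 , _ , _ , s≤s z≤n , set-sim S (toℕ-toWord w (<2^w z≤n)) , step f₀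
  simulate-basic (copy d s) s≤ s′≤ (f₀ ∷ _) S =
    1 , _ , _ , s≤s z≤n , set-sim S (registers S s) , step f₀
  simulate-basic (incr d s) {s = σ} s≤ s′≤ (f₀ ∷ f₁ ∷ _) S =
    2 , _ , _ , s≤s (s≤s z≤n) ,
    set-sim (scratch-sim S (λ _ → refl) refl)
      (trans (toℕ-toWord w (subst (_< 2 ^ w) (sym sum) (<2^w suc≤))) sum) ,
    λ h → step f₀ (step f₁ h)
    where
    suc≤ : suc (reg σ s) ≤ X
    suc≤ = subst (_≤ X) (updateAt-updates d (reg σ)) (s′≤ d)
    sum = trans (cong₂ _+_ (registers S s) (toℕ-toWord w (≤-<-trans (s≤s z≤n) X<2^w))) (+-comm (reg σ s) 1)
  simulate-basic (plus d x y) {s = σ} s≤ s′≤ (f₀ ∷ _) S =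
    1 , _ , _ , s≤s z≤n ,
    set-sim S (trans (toℕ-toWord w (subst (_< 2 ^ w) (sym sum) (<2^w sum≤))) sum) , step f₀
    where
    sum≤ : reg σ x + reg σ y ≤ X
    sum≤ = subst (_≤ X) (updateAt-updates d (reg σ)) (s′≤ d)
    sum = cong₂ _+_ (registers S x) (registers S y)
  simulate-basic (minus d x y) {s = σ} s≤ s′≤ (f₀ ∷ f₁ ∷ f₂ ∷ f₃ ∷ _) S with reg σ x <? reg σ y
  ... | yes x<y =
    2 , _ , _ , s≤s (s≤s z≤n) ,
    set-sim S (trans (toℕ-toWord w (<2^w z≤n)) (sym (m≤n⇒m∸n≡0 (<⇒≤ x<y)))) ,
    λ h → branch-taken {less x y} S f₀ x<y (step f₃ h)
  ... | no x≮y =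
    3 , _ , _ , s≤s (s≤s (s≤s z≤n)) ,
    set-sim S (trans (toℕ-fromℕ< _) (trans (cong (λ v → _%_ v (2 ^ w) {{m^n≢0 2 w}}) difference)
      (trans ([m+n]%n≡m%n (reg σ x ∸ reg σ y) (2 ^ w) {{m^n≢0 2 w}})
        (m<n⇒m%n≡m {{m^n≢0 2 w}} (<2^w (≤-trans (m∸n≤m (reg σ x) (reg σ y)) (s≤ x))))))) ,
    λ h → branch-skipped {less x y} S f₀ x≮y (step f₁ (step f₂ h))
    where
    -- When nothing is borrowed, the machine computes `2 ^ w` plus the true difference, and
    -- reduction modulo `2 ^ w` removes the summand.
    difference = trans (cong₂ (λ u v → (2 ^ w + u) ∸ v) (registers S x) (registers S y))
      (trans (+-∸-assoc (2 ^ w) (≮⇒≥ x≮y)) (+-comm (2 ^ w) _))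
  simulate-basic (get d A i) {q} {σ} {r} {m} s≤ s′≤ (f₀ ∷ f₁ ∷ f₂ ∷ f₃ ∷ f₄ ∷ f₅ ∷ _) S =
    6 , _ , _ , ≤-refl ,
    set-sim (scratch-sim S (λ _ → refl) refl)
      (trans (cong (λ u → toℕ (m u)) (toWord-toℕ w _ (toℕ-address S A (s≤ i)))) (arrays S A (reg σ i) (address< A (s≤ i)))) ,
    λ h → step f₀ (step f₁ (step f₂ (step f₃ (step f₄ (step f₅ h)))))
  simulate-basic (put A i s) {q} {σ} {r} {m} s≤ s′≤ (f₀ ∷ f₁ ∷ f₂ ∷ f₃ ∷ f₄ ∷ f₅ ∷ _) S =
    6 , _ , _ , ≤-refl ,
    store-sim (scratch-sim S (λ _ → refl) refl) (s≤ i) (toWord-toℕ w _ (toℕ-address S A (s≤ i))) (registers S s) ,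
    λ h → step f₀ (step f₁ (step f₂ (step f₃ (step f₄ (step f₅ h)))))

  -- The budget `V + t ≤ U` makes the induction go through: by `run-bounded`, time spent on a first
  -- part moves from `t` into `V`, and the sum is unchanged for the second part.
  simulate : ∀ {c : Cmd k a} {q V s s′ t r m} → Run inp c s t s′ → T (levelled c) → Bounded V s →
             (∀ i → cell inp i ≤ V) → V + t ≤ U → At program q (compile c q) → Sim s r m →
             Simulates q (end c q) (6 * t) s′ r m
  simulate {V = V} (basic {b} {s}) ok bd inp≤ V≤ at S =
    simulate-basic b (bounded≤X (≤-trans (m≤m+n V 1) V≤) bd)
                   (bounded≤X (≤-trans (≤-reflexive (+-comm 1 V)) V≤) (eval-bounded b ok bd)) at S
    where
    bounded≤X : ∀ {W s} → W ≤ U → Bounded W s → ∀ i → reg s i ≤ X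
    bounded≤X W≤U (bounded ρ≤ _) i = ≤-trans (≤-trans (ρ≤ i) (*-monoʳ-≤ (2 ^ level i) W≤U)) (level≤ i)
  simulate {V = V} {r = r} {m} (read {d} {i} {s} i<) ok bd inp≤ V≤ (f₀ ∷ _) S =
    1 , _ , _ , s≤s z≤n ,
    set-sim S (trans (cong (λ u → toℕ (m u)) (toWord-toℕ w _ (registers S i))) (input S (reg s i) i<)) , step f₀
  simulate {c = c₁ ⨾ c₂} {q} {V} (_⨾_ {t = t} {t′} ρ ρ′) ok bd inp≤ V≤ at S
    with At-compile c₁ at | Equivalence.to (T-∧ {levelled c₁}) ok
  ... | at₁ , at₂ | ok₁ , ok₂
    with simulate ρ ok₁ bd inp≤ (≤-trans (+-monoʳ-≤ V (m≤m+n t t′)) V≤) at₁ S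
  ... | u , r′ , m′ , u≤ , S′ , h
    with simulate ρ′ ok₂ (run-bounded ρ ok₁ inp≤ bd) (λ i → ≤-trans (inp≤ i) (m≤m+n V t))
           (≤-trans (≤-reflexive (+-assoc V t t′)) V≤)
           at₂ S′
  ... | u′ , r″ , m″ , u′≤ , S″ , h′ =
    u + u′ , r″ , m″ , ≤-trans (+-mono-≤ u≤ u′≤) (≤-reflexive (sym (*-distribˡ-+ 6 t t′))) , S″ , ⇒-trans h h′
  simulate {c = cond b c₁ c₂} {q} {V} (ifTrue {t = t} hb ρ) ok bd inp≤ V≤ (f₀ ∷ at) S
    with At-compile c₂ at
  ... | _ , (_ ∷ at₁)
    with simulate ρ (proj₁ (Equivalence.to (T-∧ {levelled c₁}) ok)) bd inp≤ (≤-trans (+-monoʳ-≤ V (n≤1+n t)) V≤)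
           at₁ S
  ... | u , r′ , m′ , u≤ , S′ , h =
    1 + u , r′ , m′ , ≤-trans (+-mono-≤ {1} {6} (s≤s z≤n) u≤) (≤-reflexive (sym (*-suc 6 t))) , S′ ,
    ⇒-trans (branch-taken {b} S f₀ hb) h
  simulate {c = cond b c₁ c₂} {q} {V} (ifFalse {t = t} ¬hb ρ) ok bd inp≤ V≤ (f₀ ∷ at) S
    with At-compile c₂ at
  ... | at₂ , (f₁ ∷ _)
    with simulate ρ (proj₂ (Equivalence.to (T-∧ {levelled c₁}) ok)) bd inp≤ (≤-trans (+-monoʳ-≤ V (n≤1+n t)) V≤) at₂ S
  ... | u , r′ , m′ , u≤ , S′ , h =
    1 + (u + 1) , r′ , m′ ,
    ≤-trans (≤-reflexive (+-comm 1 (u + 1)))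
      (≤-trans (≤-reflexive (+-assoc u 1 1)) (≤-trans (+-mono-≤ u≤ (s≤s (s≤s (z≤n {4}))))
        (≤-reflexive (trans (+-comm (6 * t) 6) (sym (*-suc 6 t)))))) , S′ ,
    ⇒-trans (branch-skipped {b} S f₀ ¬hb)
      (⇒-trans {t = u} {1} h (step f₁))
  simulate {c = while b c} {q} {V} (loop {t = t} {t′} hb ρ ρ′) ok bd inp≤ V≤ at@(f₀ ∷ f₁ ∷ at′) S
    with At-compile c at′
  ... | at₁ , (f₂ ∷ _)
    with simulate ρ ok bd inp≤ (≤-trans (+-monoʳ-≤ V (≤-trans (m≤m+n t t′) (n≤1+n _))) V≤) at₁ S
  ... | u , r′ , m′ , u≤ , S′ , h
    with simulate ρ′ ok (run-bounded ρ ok inp≤ bd) (λ i → ≤-trans (inp≤ i) (m≤m+n V t))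
           (≤-trans (≤-reflexive (+-assoc V t t′)) (≤-trans (+-monoʳ-≤ V (n≤1+n (t + t′))) V≤)) at S′
  ... | u′ , r″ , m″ , u′≤ , S″ , h′ =
    1 + (u + (1 + u′)) , r″ , m″ ,
    ≤-trans (≤-reflexive (cong suc (+-suc u u′)))
      (≤-trans (+-mono-≤ {2} {6} (s≤s (s≤s z≤n)) (+-mono-≤ u≤ u′≤))
        (≤-reflexive (trans (cong (6 +_) (sym (*-distribˡ-+ 6 t t′))) (sym (*-suc 6 (t + t′)))))) , S″ ,
    ⇒-trans (branch-taken {b} S f₀ hb)
      (⇒-trans {t = u} {1 + u′} h
        (⇒-trans {t = 1} {u′} (step f₂) h′))
  simulate {c = while b c} {q} (exit ¬hb) ok bd inp≤ V≤ (f₀ ∷ f₁ ∷ _) S =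
    2 , _ , _ , s≤s (s≤s z≤n) , S , ⇒-trans {t = 1} {1} (branch-skipped {b} S f₀ ¬hb) (step f₁)

-- The longest-common-subsequence recurrence and its run-compressed form

-- Position 0 stands for failure. At the bottom both branches return 0, so the value `Q 0` does not
-- affect the result.
prev : (ℕ → Bool) → ℕ → ℕ
prev Q zero    = 0
prev Q (suc g) = if Q g then g else prev Q g

prevs : (ℕ → Bool) → ℕ → ℕ → ℕ
prevs Q zero    g = g
prevs Q (suc c) g = prev Q (prevs Q c g)

hits : (ℕ → Bool) → ℕ → ℕ → ℕ
hits Q g zero    = 0
hits Q g (suc j) = if Q g then suc (hits Q (suc g) j) else hits Q (suc g) j

rank : (ℕ → Bool) → ℕ → ℕ → ℕ
rank Q n g = hits Q g (suc n ∸ g)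

-- Hits are numbered from the right end of x, starting with 1; number 0 is the sentinel `suc n`, and
-- numbers beyond the last hit give 0.
kth : (ℕ → Bool) → ℕ → ℕ → ℕ
kth Q n t = prevs Q t (suc n)

prev≤ : ∀ Q g → prev Q g ≤ g
prev≤ Q zero    = z≤n
prev≤ Q (suc g) with Q g
... | true  = n≤1+n g
... | false = m≤n⇒m≤1+n (prev≤ Q g)

prev-suc : ∀ Q g → prev Q g ≤ prev Q (suc g)
prev-suc Q g with Q g
... | true  = prev≤ Q g
... | false = ≤-refl

step-mono : (f : ℕ → ℕ) → (∀ i → f i ≤ f (suc i)) → ∀ {i j} → i ≤ j → f i ≤ f j
step-mono f f≤ {i} i≤j = go (≤⇒≤′ i≤j)
  where
  go : ∀ {j} → i ≤′ j → f i ≤ f j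
  go ≤′-refl       = ≤-refl
  go (≤′-step i≤j) = ≤-trans (go i≤j) (f≤ _)

prev-mono : ∀ Q {g h} → g ≤ h → prev Q g ≤ prev Q h
prev-mono Q = step-mono (prev Q) (prev-suc Q)

kth-antitone : ∀ Q n {s t} → s ≤ t → kth Q n t ≤ kth Q n s
kth-antitone Q n {s} s≤t = go (≤⇒≤′ s≤t)
  where
  go : ∀ {t} → s ≤′ t → kth Q n t ≤ kth Q n s
  go ≤′-refl       = ≤-refl
  go (≤′-step s≤t) = ≤-trans (prev≤ Q _) (go s≤t)

rank-top : ∀ Q n → rank Q n (suc n) ≡ 0
rank-top Q n = cong (hits Q (suc n)) (n∸n≡0 n)

rank-here : ∀ Q {n g} → g ≤ n → rank Q n g ≡ (if Q g then suc (rank Q n (suc g)) else rank Q n (suc g))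
rank-here Q {n} {g} g≤n = cong (hits Q g) (+-∸-assoc 1 g≤n)

rank-antitone : ∀ Q {n g h} → g ≤ h → h ≤ suc n → rank Q n h ≤ rank Q n g
rank-antitone Q {n} {g} g≤h = go (≤⇒≤′ g≤h)
  where
  go : ∀ {h} → g ≤′ h → h ≤ suc n → rank Q n h ≤ rank Q n g
  go ≤′-refl _ = ≤-refl
  go (≤′-step {h} g≤h) (s≤s h≤n) = ≤-trans one (go g≤h (m≤n⇒m≤1+n h≤n))
    where
    one : rank Q n (suc h) ≤ rank Q n h
    one rewrite rank-here Q h≤n with Q h
    ... | true  = n≤1+n _
    ... | false = ≤-refl

downwards : (P : ℕ → Set) → ∀ n → P n → (∀ g → g < n → P (suc g) → P g) → ∀ {g} → g ≤ n → P g
downwards P n top down g≤n = go (≤⇒≤′ g≤n) ≤-refl top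
  where
  go : ∀ {m} → _ ≤′ m → m ≤ n → P m → P _
  go ≤′-refl             _   p = p
  go (≤′-step {m} g≤m) m<n p = go g≤m (<⇒≤ m<n) (down m m<n p)

-- A step to the left of `g` finds the first hit that `rank Q n g` has not counted.
prev-kth : ∀ Q n {g} → g ≤ suc n → prev Q g ≡ kth Q n (suc (rank Q n g))
prev-kth Q n = downwards (λ g → prev Q g ≡ kth Q n (suc (rank Q n g))) (suc n)
  (cong (λ r → kth Q n (suc r)) (sym (rank-top Q n))) down
  where
  down : ∀ g → g < suc n → prev Q (suc g) ≡ kth Q n (suc (rank Q n (suc g))) →
         prev Q g ≡ kth Q n (suc (rank Q n g))
  down g (s≤s g≤n) ih rewrite rank-here Q g≤n with Q g
  ... | true  = cong (prev Q) ih
  ... | false = ih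

≤kth : ∀ Q n {g} → g ≤ suc n → ∀ {t} → t ≤ rank Q n g → g ≤ kth Q n t
≤kth Q n = downwards (λ g → ∀ {t} → t ≤ rank Q n g → g ≤ kth Q n t) (suc n)
  (λ t≤ → ≤-reflexive (cong (kth Q n) (sym (n≤0⇒n≡0 (subst (_ ≤_) (rank-top Q n) t≤))))) down
  where
  down : ∀ g → g < suc n → (∀ {t} → t ≤ rank Q n (suc g) → suc g ≤ kth Q n t) →
         ∀ {t} → t ≤ rank Q n g → g ≤ kth Q n t
  down g g<@(s≤s g≤n) ih {t} t≤ with t ≤? rank Q n (suc g)
  ... | yes t≤′ = <⇒≤ (ih t≤′)
  -- The number `t` can only be new because position `g` is itself a hit, and `prev-kth` at `suc g`
  -- identifies it as hit number `t`.
  ... | no t≰ with prev-kth Q n {suc g} g<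
  ...   | p rewrite rank-here Q g≤n with Q g
  ...     | false = contradiction t≤ t≰
  ...     | true  = ≤-reflexive (trans p (cong (kth Q n) (≤-antisym (≰⇒> t≰) t≤)))

-- At least one step is required, because the starting point `g` need not be a hit.
prevs-kth : ∀ Q n c {g} → g ≤ suc n → prevs Q (suc c) g ≡ kth Q n (rank Q n g + suc c)
prevs-kth Q n zero {g} g≤ = trans (prev-kth Q n g≤) (cong (kth Q n) (+-comm 1 (rank Q n g)))
prevs-kth Q n (suc c) {g} g≤ = trans (cong (prev Q) (prevs-kth Q n c g≤))
  (cong (kth Q n) (sym (+-suc (rank Q n g) (suc c))))

prevs≤kth : ∀ Q n c {h} → h ≤ suc n → ∀ {t} → t ≤ rank Q n h + c → prevs Q c h ≤ kth Q n t
prevs≤kth Q n zero    h≤ {t} t≤ = ≤kth Q n h≤ (subst (t ≤_) (+-identityʳ _) t≤)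
prevs≤kth Q n (suc c) h≤ t≤ = ≤-trans (≤-reflexive (prevs-kth Q n c h≤)) (kth-antitone Q n t≤)

-- With at least one step, the landing point is no further right than hit number `rank Q n g + 1`,
-- which is `prev Q g`. Without steps, monotonicity of the rank decides.
prevs≤ : ∀ Q n c {g h} → g ≤ suc n → h ≤ suc n → rank Q n g < rank Q n h + c → prevs Q c h ≤ g
prevs≤ Q n zero {g} {h} g≤ h≤ lt with h ≤? g
... | yes h≤g = h≤g
... | no h≰g = contradiction (rank-antitone Q (<⇒≤ (≰⇒> h≰g)) h≤)
                 (<⇒≱ (subst (_ <_) (+-identityʳ _) lt))
prevs≤ Q n (suc c) {g} g≤ h≤ lt =
  ≤-trans (prevs≤kth Q n (suc c) h≤ lt) (≤-trans (≤-reflexive (sym (prev-kth Q n g≤))) (prev≤ Q g))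

hit : (ℕ → Bool) → Bool → ℕ → Bool
hit Z true  g = Z g
hit Z false g = not (Z g)

-- Positions in x count from 1. reach Z n ys d is the largest g such that some
-- common subsequence of ys and the part of x starting at position g misses at
-- most d symbols of ys (n + 1 if the empty part will do), or 0 if there is none.
-- Symbols are booleans, true being the majority symbol of x.
reach : (ℕ → Bool) → ℕ → List Bool → ℕ → ℕ
reach Z n []       d       = suc n
reach Z n (c ∷ ys) zero    = prev (hit Z c) (reach Z n ys 0)
reach Z n (c ∷ ys) (suc d) = reach Z n ys d ⊔ prev (hit Z c) (reach Z n ys (suc d))

reach≤ : ∀ Z n ys d → reach Z n ys d ≤ suc n
reach≤ Z n []       d       = ≤-refl
reach≤ Z n (c ∷ ys) zero    = ≤-trans (prev≤ _ _) (reach≤ Z n ys 0)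
reach≤ Z n (c ∷ ys) (suc d) = ⊔-lub (reach≤ Z n ys d) (≤-trans (prev≤ _ _) (reach≤ Z n ys (suc d)))

reach-suc : ∀ Z n ys d → reach Z n ys d ≤ reach Z n ys (suc d)
reach-suc Z n []       d       = ≤-refl
reach-suc Z n (c ∷ ys) zero    = m≤n⇒m≤n⊔o _ (prev≤ (hit Z c) (reach Z n ys 0))
reach-suc Z n (c ∷ ys) (suc d) = ⊔-mono-≤ (reach-suc Z n ys d) (prev-mono _ (reach-suc Z n ys (suc d)))

reach-mono : ∀ Z n ys {d e} → d ≤ e → reach Z n ys d ≤ reach Z n ys e
reach-mono Z n ys = step-mono (reach Z n ys) (reach-suc Z n ys)

-- A run of minority symbols as a sliding window minimum.

module Run-of-minority (Z : ℕ → Bool) (n : ℕ) (ys : List Bool) where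

  private
    O : ℕ → Bool
    O = hit Z false

    G : ℕ → ℕ
    G = reach Z n ys

  H : ℕ → ℕ → ℕ
  H ℓ = reach Z n (replicate ℓ false ++ ys)

  -- Starting from `G j` and matching `c ≥ 1` symbols of the run leads to hit number
  -- `rank O n (G j) + c`. With `c = ℓ - (d - j)` this is `key j + ℓ - d`, so candidates from
  -- different columns are compared by a quantity that depends neither on `ℓ` nor on `d`.
  key : ℕ → ℕ
  key j = rank O n (G j) + j

  -- Another deletion can only move `G` to the right and so lower the rank; the sole increase is
  -- that of the summand `j`.
  key-suc : ∀ j → key (suc j) ≤ suc (key j)
  key-suc j = ≤-trans (+-monoˡ-≤ (suc j) (rank-antitone O (reach-suc Z n ys j) (reach≤ Z n ys (suc j))))
                      (≤-reflexive (+-suc (rank O n (G j)) j))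

  -- Match `c` symbols of the run and delete the other `e`. As all of them are equal, it is enough
  -- to delete the ones nearest to `ys`.
  candidate≤ : ∀ c e j → prevs O c (G j) ≤ H (c + e) (j + e)
  candidate≤ zero zero j = ≤-reflexive (cong G (sym (+-identityʳ j)))
  candidate≤ zero (suc e) j rewrite +-suc j e = ≤-trans (candidate≤ zero e j) (m≤m⊔n _ _)
  candidate≤ (suc c) e j = ≤-trans (prev-mono O (candidate≤ c e j)) (prev≤H (c + e) (j + e))
    where
    prev≤H : ∀ ℓ d → prev O (H ℓ d) ≤ H (suc ℓ) d
    prev≤H ℓ zero    = ≤-refl
    prev≤H ℓ (suc d) = m≤n⊔m _ _

  -- Unfolding each maximum gives a sequence of matches and deletions. A deletion leaves the
  -- position in place, so only the two totals matter and not their order.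
  some-candidate : ∀ ℓ d → ∃[ c ] ∃[ e ] ∃[ j ] (c + e ≡ ℓ × j + e ≡ d × H ℓ d ≡ prevs O c (G j))
  some-candidate zero d = 0 , 0 , d , refl , +-identityʳ d , refl
  some-candidate (suc ℓ) zero with some-candidate ℓ zero
  ... | c , e , j , c+e , j+e , eq = suc c , e , j , cong suc c+e , j+e , cong (prev O) eq
  some-candidate (suc ℓ) (suc d) with ⊔-sel (H ℓ d) (prev O (H ℓ (suc d)))
  ... | inj₁ left with some-candidate ℓ d
  ...   | c , e , j , c+e , j+e , eq =
    c , suc e , j , trans (+-suc c e) (cong suc c+e) , trans (+-suc j e) (cong suc j+e) , trans left eq
  some-candidate (suc ℓ) (suc d) | inj₂ right with some-candidate ℓ (suc d)
  ...   | c , e , j , c+e , j+e , eq = suc c , e , j , cong suc c+e , j+e , trans right (cong (prev O) eq)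

  private
    exchange : ∀ r j c e → r + j + (c + e) ≡ r + c + (j + e)
    exchange = solve-∀

  LastOccurrence : ℕ → ℕ → ℕ → Set
  LastOccurrence d u i = i ≤ d × key i ≡ u × (∀ j → i < j → j ≤ d → u < key j)

  newest : ∀ d → LastOccurrence d (key d) d
  newest d = ≤-refl , refl , λ j d<j j≤d → contradiction j≤d (<⇒≱ d<j)

  -- The window once column `d` has been entered. `minimal` makes `W` a lower bound on its keys, and
  -- `fresh` puts the latest occurrence of `W` inside it, so `W` is the minimum.
  record Settled (ℓ d W : ℕ) (last : ℕ → ℕ) : Set where
    field
      latest  : ∀ u → W ≤ u → u ≤ key d →
                LastOccurrence d u (last u)
      minimal : ∀ j → j ≤ d → d ≤ j + ℓ → W ≤ key j
      fresh   : d ≤ last W + ℓ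
      W≤      : W ≤ key d

  -- The window before column d is processed. Keys grow by at most one per
  -- column, so every value between the window minimum W and the newest key
  -- has occurred, and last holds its latest occurrence.
  record Window (ℓ d W : ℕ) (last : ℕ → ℕ) : Set where
    field
      latest  : ∀ u → W ≤ u → u < key d →
                last u < d × key (last u) ≡ u × (∀ j → last u < j → j < d → u < key j)
      minimal : ∀ j → j < d → d ≤ suc (j + ℓ) → W ≤ key j
      fresh   : W < key d → d ≤ suc (last W + ℓ)

  -- Nothing is asked of `last`: entries left by an earlier row do no harm, since only values
  -- already seen in the current row are looked up.
  window-start : ∀ ℓ W last → key 0 ≤ W → Window ℓ 0 W last
  window-start ℓ W last key≤ = record
    { latest  = λ u W≤u u< → contradiction u< (≤⇒≯ (≤-trans key≤ W≤u))
    ; minimal = λ j ()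
    ; fresh   = λ W< → contradiction W< (≤⇒≯ key≤)
    }

  -- This is where slow growth of the keys is used: by `key-suc`, every value below the next key is
  -- at most `key d` and therefore already tracked.
  window-next : ∀ {ℓ d W last} → Settled ℓ d W last → Window ℓ (suc d) W last
  window-next {d = d} S = record
    { latest  = λ u W≤u u< → let l≤ , k≡ , after = latest u W≤u (≤-pred (≤-trans u< (key-suc d)))
                             in s≤s l≤ , k≡ , λ j l<j j< → after j l<j (≤-pred j<)
    ; minimal = λ j j< d≤ → minimal j (≤-pred j<) (≤-pred d≤)
    ; fresh   = λ _ → s≤s fresh
    }
    where open Settled S

  -- When the new key is at most the old minimum, the tracked values shrink to that key alone, whose
  -- entry has just been written.
  settle-drop : ∀ {ℓ d W last v} → v ≡ key d → Window ℓ d W last → v ≤ W → Settled ℓ d v (last [ v ≔ d ])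
  settle-drop {ℓ} {d} {W} {last} refl S k≤W = record
    { latest  = λ u k≤u u≤k → subst (λ v → LastOccurrence d v ((last [ key d ≔ d ]) v)) (≤-antisym k≤u u≤k)
                                (subst (LastOccurrence d (key d)) (sym here) (newest d))
    ; minimal = min
    ; fresh   = ≤-trans (m≤m+n d ℓ) (≤-reflexive (cong (_+ ℓ) (sym here)))
    ; W≤      = ≤-refl
    }
    where
    open Window S
    here = [≔]-same last (key d) d
    min : ∀ j → j ≤ d → d ≤ j + ℓ → key d ≤ key j
    min j j≤d d≤ with m≤n⇒m<n∨m≡n j≤d
    ... | inj₁ j<d  = ≤-trans k≤W (minimal j j<d (m≤n⇒m≤1+n d≤))
    ... | inj₂ refl = ≤-refl

  private
    latest-update : ∀ {ℓ d W last} → Window ℓ d W last → ∀ u → W ≤ u → u ≤ key d →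
      LastOccurrence d u ((last [ key d ≔ d ]) u)
    latest-update {d = d} {last = last} S u W≤u u≤ with m≤n⇒m<n∨m≡n u≤
    ... | inj₂ refl = subst (LastOccurrence d u) (sym ([≔]-same last u d)) (newest d)
    ... | inj₁ u<k = subst (LastOccurrence d u) (sym ([≔]-other last (key d) d u (λ e → <⇒≢ u<k (sym e))))
                       (<⇒≤ l< , k≡ , later)
      where
      old = Window.latest S u W≤u u<k
      l< = proj₁ old
      k≡ = proj₁ (proj₂ old)
      after = proj₂ (proj₂ old)
      later : ∀ j → last u < j → j ≤ d → u < key j
      later j l<j j≤d with m≤n⇒m<n∨m≡n j≤d
      ... | inj₁ j<d  = after j l<j j<d
      ... | inj₂ refl = u<k

  settle-keep : ∀ {ℓ d W last v} → v ≡ key d → Window ℓ d W last → W < v → d ≤ (last [ v ≔ d ]) W + ℓ →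
                Settled ℓ d W (last [ v ≔ d ])
  settle-keep {ℓ} {d} {W} refl S W<k d≤ = record
    { latest  = latest-update S
    ; minimal = min
    ; fresh   = d≤
    ; W≤      = <⇒≤ W<k
    }
    where
    min : ∀ j → j ≤ d → d ≤ j + ℓ → W ≤ key j
    min j j≤d d≤ with m≤n⇒m<n∨m≡n j≤d
    ... | inj₁ j<d  = Window.minimal S j j<d (m≤n⇒m≤1+n d≤)
    ... | inj₂ refl = <⇒≤ W<k

  -- Since values have no gaps, `suc W` has occurred too, and later than the last `W`; as `W` was in
  -- the window one column ago, `suc W` is in it now. One increment of the minimum per column is
  -- thus always enough.
  settle-expire : ∀ {ℓ d W last v} → v ≡ key d → Window ℓ d W last → W < v → (last [ v ≔ d ]) W + ℓ < d →
                  Settled ℓ d (suc W) (last [ v ≔ d ])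
  settle-expire {ℓ} {d} {W} {last} refl S W<k expired = record
    { latest  = λ u W<u → latest-update S u (<⇒≤ W<u)
    ; minimal = λ j j≤d d≤ → after j (+-cancelʳ-< ℓ (last′ W) j (<-≤-trans expired d≤)) j≤d
    ; fresh   = ≤-trans d≤ (+-monoˡ-≤ ℓ last<)
    ; W≤      = W<k
    }
    where
    last′ = last [ key d ≔ d ]
    after = proj₂ (proj₂ (latest-update S W ≤-refl (<⇒≤ W<k)))
    d≤ : d ≤ suc (last′ W + ℓ)
    d≤ = subst (λ l → d ≤ suc (l + ℓ)) (sym ([≔]-other last (key d) d W (λ e → <⇒≢ W<k (sym e))))
           (Window.fresh S W<k)
    last< : last′ W < last′ (suc W)
    -- Were the last `W` later than the last `suc W`, its key would have to exceed `suc W`; in the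
    -- same column both cannot occur.
    last< with latest-update S (suc W) (n≤1+n W) W<k | last′ W <? last′ (suc W)
    ... | _ | yes l< = l<
    ... | l≤ , k≡ , after′ | no l≮ with m≤n⇒m<n∨m≡n (≮⇒≥ l≮)
    ...   | inj₁ l> = contradiction (after′ (last′ W) l> (proj₁ (latest-update S W ≤-refl (<⇒≤ W<k))))
                        (≤⇒≯ (≤-trans (≤-reflexive (proj₁ (proj₂ (latest-update S W ≤-refl (<⇒≤ W<k))))) (n≤1+n W)))
    ...   | inj₂ l≡ = contradiction (trans (sym k≡) (trans (cong key l≡)
                        (proj₁ (proj₂ (latest-update S W ≤-refl (<⇒≤ W<k)))))) 1+n≢n

  module _ {ℓ d W last} (S : Settled ℓ d W last) where
    open Settled S

    private
      b = last W
      b≤d = proj₁ (latest W ≤-refl W≤)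
      key-b = proj₁ (proj₂ (latest W ≤-refl W≤))
      after = proj₂ (proj₂ (latest W ≤-refl W≤))

    -- The best column `b` is the oldest in the window, so from it the whole run is deleted and the
    -- position `G b`, not necessarily a hit, is kept. A candidate that matches a symbol starts at
    -- some `j > b` with a strictly larger key and falls under `prevs≤`.
    settled-exact : b + ℓ ≡ d → H ℓ d ≡ G b
    settled-exact refl with some-candidate ℓ (b + ℓ)
    ... | zero , e , j , refl , j+e , eq = trans eq (cong G (+-cancelʳ-≡ e j b j+e))
    ... | suc c , e , j , refl , j+e , eq =
      ≤-antisym (≤-trans (≤-reflexive eq) (prevs≤ O n (suc c) (reach≤ Z n ys b) (reach≤ Z n ys j) smaller))
                (candidate≤ 0 ℓ b)
      where
      b<j : b < j
      b<j = +-cancelʳ-< e b j (≤-trans (+-monoʳ-< b (s≤s (m≤n+m e c))) (≤-reflexive (sym j+e)))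
      smaller : rank O n (G b) < rank O n (G j) + suc c
      smaller = +-cancelʳ-< (b + ℓ) _ _ (subst₂ _<_ (+-assoc (rank O n (G b)) b ℓ)
        (trans (exchange (rank O n (G j)) j (suc c) e) (cong (rank O n (G j) + suc c +_) j+e))
        (+-monoˡ-< ℓ (subst (_< key j) (sym key-b) (after j b<j (≤-trans (m≤m+n j e) (≤-reflexive j+e))))))

    -- From column `b` at least one symbol is matched, so the landing point is a hit, and the least
    -- key in the window gives the hit furthest to the right.
    settled-kth : d < b + ℓ → H ℓ d ≡ kth O n (W + ℓ ∸ d)
    settled-kth d<b+ℓ with m≤n⇒∃[o]m+o≡n d<b+ℓ | m≤n⇒∃[o]m+o≡n b≤d
    ... | c , d+c | f , b+f = ≤-antisym upper lower
      where
      target : W + ℓ ∸ d ≡ rank O n (G b) + suc c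
      target = begin
        W + ℓ ∸ d                         ≡⟨ cong (λ v → v + ℓ ∸ d) key-b ⟨
        rank O n (G b) + b + ℓ ∸ d        ≡⟨ cong (_∸ d) (+-assoc (rank O n (G b)) b ℓ) ⟩
        rank O n (G b) + (b + ℓ) ∸ d      ≡⟨ cong (λ v → rank O n (G b) + v ∸ d) d+c ⟨
        rank O n (G b) + (suc d + c) ∸ d  ≡⟨ cong (λ v → rank O n (G b) + v ∸ d) (trans (cong suc (+-comm d c)) refl) ⟩
        rank O n (G b) + (suc c + d) ∸ d  ≡⟨ cong (_∸ d) (+-assoc (rank O n (G b)) (suc c) d) ⟨
        rank O n (G b) + suc c + d ∸ d    ≡⟨ m+n∸n≡m (rank O n (G b) + suc c) d ⟩
        rank O n (G b) + suc c ∎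
        where open ≡-Reasoning
      ℓ≡ : suc c + f ≡ ℓ
      ℓ≡ = +-cancelˡ-≡ b _ _ (trans (rearrange b c f) (trans (cong (λ v → suc v + c) b+f) d+c))
        where
        rearrange : ∀ b c f → b + (suc c + f) ≡ suc (b + f) + c
        rearrange = solve-∀
      lower : kth O n (W + ℓ ∸ d) ≤ H ℓ d
      lower = subst₂ _≤_ (trans (prevs-kth O n c (reach≤ Z n ys b)) (cong (kth O n) (sym target)))
        (cong₂ H ℓ≡ b+f) (candidate≤ (suc c) f b)
      upper : H ℓ d ≤ kth O n (W + ℓ ∸ d)
      upper with some-candidate ℓ d
      ... | c′ , e , j , c+e , j+e , eq = ≤-trans (≤-reflexive eq) (prevs≤kth O n c′ (reach≤ Z n ys j)
        (m≤n+o⇒m∸n≤o (W + ℓ) d (≤-trans (+-monoˡ-≤ ℓ (minimal j (m+n≤o⇒m≤o j (≤-reflexive j+e)) d≤j+ℓ))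
          (≤-reflexive (trans (cong (key j +_) (sym c+e))
            (trans (exchange (rank O n (G j)) j c′ e)
              (trans (cong (rank O n (G j) + c′ +_) j+e) (+-comm (rank O n (G j) + c′) d))))))))
        where
        d≤j+ℓ : d ≤ j + ℓ
        d≤j+ℓ = ≤-trans (≤-reflexive (sym j+e)) (+-monoʳ-≤ j (≤-trans (m≤n+m e c′) (≤-reflexive c+e)))

    settled-best≤ : b ≤ d
    settled-best≤ = b≤d

    -- Needed for the lookup, because the stored table of hits is valid only from index 1 on.
    settled-target : d < b + ℓ → 1 ≤ W + ℓ ∸ d
    settled-target d< = m<n⇒0<n∸m (<-≤-trans d< (+-monoˡ-≤ ℓ (≤-trans (m≤n+m b _) (≤-reflexive key-b))))

-- Longest common subsequences and matching pairs of binary strings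

isSymbol : Fin 2 → Fin 2 → Bool
isSymbol Z c = toℕ c ≡ᵇ toℕ Z

isSymbol-injective : ∀ Z c c′ → isSymbol Z c ≡ isSymbol Z c′ → c ≡ c′
isSymbol-injective Z zero zero _ = refl
isSymbol-injective zero zero (suc zero) ()
isSymbol-injective (suc zero) zero (suc zero) ()
isSymbol-injective zero (suc zero) zero ()
isSymbol-injective (suc zero) (suc zero) zero ()
isSymbol-injective Z (suc zero) (suc zero) _ = refl

drop-∷ : ∀ {A : Set} (xs : List A) g → g < length xs → ∃[ c ] (drop g xs ≡ c ∷ drop (suc g) xs)
drop-∷ (x ∷ xs) zero    _         = x , refl
drop-∷ (x ∷ xs) (suc g) (s≤s g<) = drop-∷ xs g g<

drop-∷⇒< : ∀ {A : Set} (xs : List A) g {c r} → drop g xs ≡ c ∷ r → g < length xs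
drop-∷⇒< (x ∷ xs) zero    _ = s≤s z≤n
drop-∷⇒< (x ∷ xs) (suc g) e = s≤s (drop-∷⇒< xs g e)

drop-antitone : ∀ {A : Set} (xs : List A) {g h} → g ≤ h → drop h xs ⊆ drop g xs
drop-antitone xs {h = zero} z≤n = ⊆-refl
drop-antitone [] {h = suc h} z≤n = ⊆-refl
drop-antitone (x ∷ xs) {h = suc h} z≤n = x ∷ʳ drop-antitone xs {0} {h} z≤n
drop-antitone []       (s≤s g≤h) = ⊆-refl
drop-antitone (x ∷ xs) (s≤s g≤h) = drop-antitone xs g≤h

∷⊆⇒drop : ∀ {A : Set} {c : A} {z us} → c ∷ z ⊆ us →
          ∃[ k ] (drop k us ≡ c ∷ drop (suc k) us × z ⊆ drop (suc k) us)
∷⊆⇒drop (u ∷ʳ τ) with ∷⊆⇒drop τ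
... | k , e , σ = suc k , e , σ
∷⊆⇒drop (refl ∷ τ) = 0 , refl , τ

prev-hit : ∀ Q h {g} → prev Q h ≡ suc g → Q (suc g) ≡ true × suc g < h
prev-hit Q (suc h) e with Q h in q
prev-hit Q (suc h) refl | true  = q , ≤-refl
prev-hit Q (suc h) e    | false with prev-hit Q h e
... | q′ , g< = q′ , m≤n⇒m≤1+n g<

≤prev : ∀ Q {g h} → Q g ≡ true → g < h → g ≤ prev Q h
≤prev Q {g} {h} q g<h = ≤-trans at-g (prev-mono Q g<h)
  where
  at-g : g ≤ prev Q (suc g)
  at-g rewrite q = ≤-refl

hit-self : ∀ Z c g → Z g ≡ c → hit Z c g ≡ true
hit-self Z true  g e = e
hit-self Z false g e = cong not e

hit⇒≡ : ∀ Z c g → hit Z c g ≡ true → Z g ≡ c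
hit⇒≡ Z true  g e = e
hit⇒≡ Z false g e = not-injective e

-- Reach values and longest common subsequences.

module Reach (xs : BinString) (Z : Fin 2) (isZ : ℕ → Bool)
             (reads : ∀ g {c r} → drop g xs ≡ c ∷ r → isZ (suc g) ≡ isSymbol Z c) where

  R : BinString → ℕ → ℕ
  R ys = reach isZ (length xs) (map (isSymbol Z) ys)

  prepend : ∀ {h g c z} → prev (hit isZ (isSymbol Z c)) (suc h) ≡ suc g → h ≤ length xs →
            z ⊆ drop h xs → c ∷ z ⊆ drop g xs
  prepend {h} {g} {c} {z} e h≤ τ with prev-hit (hit isZ (isSymbol Z c)) (suc h) e
  ... | q , s≤s g<h with drop-∷ xs g (<-≤-trans g<h h≤)
  ...   | c′ , dr = subst (c ∷ z ⊆_) (sym dr) (sym c′≡c ∷ ⊆-trans τ (drop-antitone xs g<h))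
    where
    c′≡c : c′ ≡ c
    c′≡c = isSymbol-injective Z c′ c
             (trans (sym (reads g dr)) (hit⇒≡ isZ (isSymbol Z c) (suc g) q))

  Witness : BinString → ℕ → ℕ → Set
  Witness ys d g = ∃[ z ] (z ⊆ drop g xs × z ⊆ ys × length ys ≤ length z + d)

  -- Position `suc g`, counted from 1, begins the suffix `drop g xs`. Asking for a successor also
  -- excludes the failure value 0.
  reach-sound : ∀ ys d {g} → R ys d ≡ suc g → Witness ys d g
  reach-match : ∀ c ys d {g} → prev (hit isZ (isSymbol Z c)) (R ys d) ≡ suc g → Witness (c ∷ ys) d g

  reach-sound []       d e = [] , minimum _ , minimum _ , z≤n
  reach-sound (c ∷ ys) zero e = reach-match c ys 0 e
  reach-sound (c ∷ ys) (suc d) {g} e with ⊔-sel (R ys d) (prev (hit isZ (isSymbol Z c)) (R ys (suc d)))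
  ... | inj₂ right = reach-match c ys (suc d) (trans (sym right) e)
  ... | inj₁ left with reach-sound ys d {g} (trans (sym left) e)
  ...   | z , τ , σ , len = z , τ , c ∷ʳ σ , ≤-trans (s≤s len) (≤-reflexive (sym (+-suc (length z) d)))

  reach-match c ys d {g} e with R ys d in eq
  ... | suc h with reach-sound ys d eq
  ...   | z , τ , σ , len = c ∷ z , prepend {h} e (≤-pred (subst (_≤ suc (length xs)) eq (reach≤ isZ _ (map (isSymbol Z) ys) d))) τ ,
                            refl ∷ σ , s≤s len

  -- A greedy argument: if the first symbol is matched at `suc (g + k)`, the rest can start strictly
  -- after it by induction, and `prev` selects a hit no further left than `suc (g + k)`.
  reach-complete : ∀ {z ys} → z ⊆ ys → ∀ d g → z ⊆ drop g xs → length ys ≤ length z + d →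
                   g ≤ length xs → suc g ≤ R ys d
  reach-complete [] d g τ len g≤ = s≤s g≤
  reach-complete {z} (_∷ʳ_ {ys = ys} c σ) zero g τ len g≤ =
    contradiction (≤-trans len (≤-reflexive (+-identityʳ (length z)))) (≤⇒≯ (length-mono-≤ σ))
  reach-complete {z} (c ∷ʳ σ) (suc d) g τ len g≤ =
    m≤n⇒m≤n⊔o _ (reach-complete σ d g τ (≤-pred (≤-trans len (≤-reflexive (+-suc (length z) d)))) g≤)
  reach-complete {c ∷ z} {_ ∷ ys} (refl ∷ σ) d g τ len g≤ with ∷⊆⇒drop τ
  ... | k , e , τ′ = ≤-trans (s≤s (m≤m+n g k)) (≤-trans matched (match≤ d))
    where
    Q = hit isZ (isSymbol Z c)
    e′ : drop (g + k) xs ≡ c ∷ drop (suc k) (drop g xs)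
    e′ = trans (sym (drop-drop g k xs)) e
    τ″ : z ⊆ drop (suc (g + k)) xs
    τ″ = subst (z ⊆_) (trans (drop-drop g (suc k) xs) (cong (λ l → drop l xs) (+-suc g k))) τ′
    matched : suc (g + k) ≤ prev Q (R ys d)
    matched = ≤prev Q (hit-self isZ (isSymbol Z c) (suc (g + k)) (reads (g + k) e′))
      (reach-complete σ d (suc (g + k)) τ″ (≤-pred len) (drop-∷⇒< xs (g + k) e′))
    match≤ : ∀ d → prev Q (R ys d) ≤ R (c ∷ ys) d
    match≤ zero    = ≤-refl
    match≤ (suc d) = m≤n⊔m (R ys d) _

  -- Describes `m - L` as the first column with a nonzero reach value, which is the form in which
  -- the program finds it.
  Deletions : BinString → ℕ → Set
  Deletions ys δ = δ ≤ length ys × 0 < R ys δ × (∀ d → d < δ → R ys d ≡ 0)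

  deletions : ∀ ys → ∃[ δ ] Deletions ys δ
  deletions ys = search (length ys) ≤-refl
                   (reach-complete (minimum ys) (length ys) 0 (minimum _) ≤-refl z≤n)
    where
    search : ∀ d → d ≤ length ys → 0 < R ys d → ∃[ δ ] Deletions ys δ
    search zero    d≤ pos = 0 , d≤ , pos , λ _ ()
    search (suc d) d≤ pos with R ys d in eq
    ... | suc _ = search d (<⇒≤ d≤) (subst (0 <_) (sym eq) (s≤s z≤n))
    ... | zero  = suc d , d≤ , pos ,
      λ e e< → n≤0⇒n≡0 (subst (R ys e ≤_) eq (reach-mono isZ _ (map (isSymbol Z) ys) (≤-pred e<)))

  deletions⇒LCS : ∀ ys {δ} → Deletions ys δ → LCSLength xs ys (length ys ∸ δ)
  deletions⇒LCS ys {δ} (δ≤ , pos , least) = longest (R ys δ) refl pos , bound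
    where
    m = length ys
    bound : ∀ z → CommonSubsequence xs ys z → length z ≤ m ∸ δ
    bound z (τ , σ) with m ∸ length z <? δ
    ... | no ≥δ = m+n≤o⇒n≤o∸m′ (≮⇒≥ ≥δ)
      where
      m+n≤o⇒n≤o∸m′ : δ ≤ m ∸ length z → length z ≤ m ∸ δ
      m+n≤o⇒n≤o∸m′ δ≤′ = m+n≤o⇒m≤o∸n (length z) (≤-trans (+-monoʳ-≤ (length z) δ≤′)
                           (≤-reflexive (m+[n∸m]≡n (length-mono-≤ σ))))
    ... | yes <δ = contradiction
      (≤-trans (reach-complete σ (m ∸ length z) 0 τ (≤-reflexive (sym (m+[n∸m]≡n (length-mono-≤ σ)))) z≤n)
               (≤-reflexive (least _ <δ))) (λ ())
    longest : ∀ r → R ys δ ≡ r → 0 < r → ∃[ z ] (CommonSubsequence xs ys z × length z ≡ m ∸ δ)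
    longest (suc g) e _ with reach-sound ys δ e
    ... | z , τ , σ , len = z , common , ≤-antisym (bound z common)
            (m≤n+o⇒m∸n≤o m δ (≤-trans len (≤-reflexive (+-comm (length z) δ))))
      where common = ⊆-trans τ (drop-antitone xs {0} {g} z≤n) , σ

-- Symbol counts and matching pairs.

count : Fin 2 → BinString → ℕ
count c xs = length (filter (_≟ᶠ c) xs)

count-same : ∀ c xs → count c (c ∷ xs) ≡ suc (count c xs)
count-same c xs = cong length (filter-accept (_≟ᶠ c) {c} {xs} refl)

count-other : ∀ {b c} xs → b ≢ c → count c (b ∷ xs) ≡ count c xs
count-other {b} {c} xs b≢c = cong length (filter-reject (_≟ᶠ c) {b} {xs} b≢c)

count-total : ∀ xs → count zero xs + count (suc zero) xs ≡ length xs
count-total []              = refl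
count-total (zero ∷ xs)     = cong suc (count-total xs)
count-total (suc zero ∷ xs) = trans (+-suc _ _) (cong suc (count-total xs))

length-filter-∷ : ∀ {A B : Set} {S : A × B → Set} (S? : Decidable S) a as (bs : List B) →
  length (filter S? (cartesianProduct (a ∷ as) bs)) ≡
  length (filter S? (map (a ,_) bs)) + length (filter S? (cartesianProduct as bs))
length-filter-∷ S? a as bs = trans (cong length (filter-++ S? (map (a ,_) bs) (cartesianProduct as bs)))
                                   (length-++ (filter S? (map (a ,_) bs)))

length-filter-product : ∀ {A B : Set} {P : A → Set} {Q : B → Set} {S : A × B → Set}
  (P? : Decidable P) (Q? : Decidable Q) (S? : Decidable S) → (∀ {a b} → P a → Q b → S (a , b)) →
  ∀ as bs → length (filter P? as) * length (filter Q? bs) ≤ length (filter S? (cartesianProduct as bs))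
length-filter-product P? Q? S? both [] bs = z≤n
length-filter-product P? Q? S? both (a ∷ as) bs with P? a
... | no _  = ≤-trans (≤-trans (length-filter-product P? Q? S? both as bs) (m≤n+m _ _))
                      (≤-reflexive (sym (length-filter-∷ S? a as bs)))
... | yes p = ≤-trans (+-mono-≤ (row bs) (length-filter-product P? Q? S? both as bs))
                      (≤-reflexive (sym (length-filter-∷ S? a as bs)))
  where
  row : ∀ bs → length (filter Q? bs) ≤ length (filter S? (map (a ,_) bs))
  row [] = z≤n
  row (b ∷ bs) with Q? b | S? (a , b)
  ... | yes q | yes _ = s≤s (row bs)
  ... | yes q | no ¬s = contradiction (both p q) ¬s
  ... | no _  | yes _ = m≤n⇒m≤1+n (row bs)
  ... | no _  | no _  = row bs

length-filter-map : ∀ {A B : Set} {P : B → Set} (P? : Decidable P) (f : A → B) as →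
                    length (filter P? (map f as)) ≡ length (filter (λ a → P? (f a)) as)
length-filter-map P? f [] = refl
length-filter-map P? f (a ∷ as) with P? (f a)
... | yes _ = cong suc (length-filter-map P? f as)
... | no _  = length-filter-map P? f as

count-lookup : ∀ c xs → count c xs ≡ length (filter (λ i → lookup xs i ≟ᶠ c) (allFin (length xs)))
count-lookup c xs = trans
  (cong (count c) (sym (trans (map-tabulate (λ i → i) (lookup xs)) (tabulate-lookup xs))))
  (length-filter-map (_≟ᶠ c) (lookup xs) (allFin (length xs)))

-- The pairs whose two entries are both `c` form a product set within the matching pairs. For the
-- majority symbol this yields `p n ≤ 2 M`.
count*count≤matching : ∀ c xs ys → count c xs * count c ys ≤ #matchingPairs xs ys
count*count≤matching c xs ys = subst₂ (λ a b → a * b ≤ #matchingPairs xs ys)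
  (sym (count-lookup c xs)) (sym (count-lookup c ys))
  (length-filter-product _ _ _ (λ p q → trans p (sym q)) (allFin (length xs)) (allFin (length ys)))

-- runs len j is the string consisting of j + 1 runs of the minority symbol
-- separated by single majority symbols; len 0 is the length of the last run.
runs : (ℕ → ℕ) → ℕ → List Bool
separated : (ℕ → ℕ) → ℕ → List Bool

runs len j = replicate (len j) false ++ separated len j

separated len zero    = []
separated len (suc j) = true ∷ runs len j

runs-cong : ∀ {len len′} j → (∀ i → i ≤ j → len i ≡ len′ i) → runs len j ≡ runs len′ j
runs-cong zero    e rewrite e 0 z≤n = refl
runs-cong {len} {len′} (suc j) e rewrite e (suc j) ≤-refl =
  cong (λ s → replicate (len′ (suc j)) false ++ true ∷ s) (runs-cong j (λ i i≤ → e i (m≤n⇒m≤1+n i≤)))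

-- With y scanned from the right, a minority symbol prolongs the leftmost run found so far, which is
-- the one with index `j`.
runs-extend : ∀ len j → runs (len [ j ≔ suc (len j) ]) j ≡ false ∷ runs len j
runs-extend len j = trans (cong (λ l → replicate l false ++ separated len′ j) ([≔]-same len j (suc (len j))))
    (cong (λ s → false ∷ replicate (len j) false ++ s)
      (rest j (λ i → [≔]-other len j (suc (len j)) i)))
  where
  len′ = len [ j ≔ suc (len j) ]
  rest : ∀ j → (∀ i → j ≢ i → len′ i ≡ len i) → separated len′ j ≡ separated len j
  rest zero    e = refl
  rest (suc j) e = cong (true ∷_) (runs-cong j (λ i i≤ → e i (λ j≡i → <⇒≢ (s≤s i≤) (sym j≡i))))

-- The program

_==_ : ∀ {n} → Fin n → Fin n → Bool
i == j = toℕ i ≡ᵇ toℕ j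

target : ∀ {k a} → Basic k a → Fin k → Bool
target (clear d)     r = d == r
target (copy d _)    r = d == r
target (incr d _)    r = d == r
target (plus d _ _)  r = d == r
target (minus d _ _) r = d == r
target (get d _ _)   r = d == r
target (put _ _ _)   r = false

-- Boolean-valued so that, for concrete code, every frame condition holds by evaluation.
writesReg : ∀ {k a} → Cmd k a → Fin k → Bool
writesReg (basic b)     r = target b r
writesReg (read d _)    r = d == r
writesReg (c ⨾ c′)      r = writesReg c r ∨ writesReg c′ r
writesReg (cond _ c c′) r = writesReg c r ∨ writesReg c′ r
writesReg (while _ c)   r = writesReg c r

writesArr : ∀ {k a} → Cmd k a → Fin a → Bool
writesArr (basic (put A _ _)) B = A == B
writesArr (basic _)     B = false
writesArr (read d _)    B = false
writesArr (c ⨾ c′)      B = writesArr c B ∨ writesArr c′ B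
writesArr (cond _ c c′) B = writesArr c B ∨ writesArr c′ B
writesArr (while _ c)   B = writesArr c B

==-distinct : ∀ {n} {i j : Fin n} → (i == j) ≡ false → j ≢ i
==-distinct {i = i} e refl = subst T e (≡⇒≡ᵇ (toℕ i) (toℕ i) refl)

frame-reg : ∀ {k a inp t} {c : Cmd k a} {s s′} → Run inp c s t s′ →
            ∀ r → writesReg c r ≡ false → reg s′ r ≡ reg s r
frame-reg (basic {clear d} {s})     r e = updateAt-minimal r d (reg s) (==-distinct e)
frame-reg (basic {copy d _} {s})    r e = updateAt-minimal r d (reg s) (==-distinct e)
frame-reg (basic {incr d _} {s})    r e = updateAt-minimal r d (reg s) (==-distinct e)
frame-reg (basic {plus d _ _} {s})  r e = updateAt-minimal r d (reg s) (==-distinct e)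
frame-reg (basic {minus d _ _} {s}) r e = updateAt-minimal r d (reg s) (==-distinct e)
frame-reg (basic {get d _ _} {s})   r e = updateAt-minimal r d (reg s) (==-distinct e)
frame-reg (basic {put _ _ _})       r e = refl
frame-reg (read {d} {s = s} _)      r e = updateAt-minimal r d (reg s) (==-distinct e)
frame-reg (_⨾_ {c} {c′} ρ ρ′)       r e =
  trans (frame-reg ρ′ r (∨-conicalʳ (writesReg c r) _ e)) (frame-reg ρ r (∨-conicalˡ _ (writesReg c′ r) e))
frame-reg (ifTrue {c = c} {c′} _ ρ)   r e = frame-reg ρ r (∨-conicalˡ _ (writesReg c′ r) e)
frame-reg (ifFalse {c = c} {c′} _ ρ)   r e = frame-reg ρ r (∨-conicalʳ (writesReg c r) _ e)
frame-reg (loop _ ρ ρ′)             r e = trans (frame-reg ρ′ r e) (frame-reg ρ r e)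
frame-reg (exit _)                  r e = refl

frame-arr : ∀ {k a inp t} {c : Cmd k a} {s s′} → Run inp c s t s′ →
            ∀ A → writesArr c A ≡ false → arr s′ A ≡ arr s A
frame-arr (basic {clear _})           A e = refl
frame-arr (basic {copy _ _})          A e = refl
frame-arr (basic {incr _ _})          A e = refl
frame-arr (basic {plus _ _ _})        A e = refl
frame-arr (basic {minus _ _ _})       A e = refl
frame-arr (basic {get _ _ _})         A e = refl
frame-arr (basic {put B _ _} {s})     A e = updateAt-minimal A B (arr s) (==-distinct e)
frame-arr (read _)                    A e = refl
frame-arr (_⨾_ {c} {c′} ρ ρ′)         A e =
  trans (frame-arr ρ′ A (∨-conicalʳ (writesArr c A) _ e)) (frame-arr ρ A (∨-conicalˡ _ (writesArr c′ A) e))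
frame-arr (ifTrue {c = c} {c′} _ ρ)     A e = frame-arr ρ A (∨-conicalˡ _ (writesArr c′ A) e)
frame-arr (ifFalse {c = c} {c′} _ ρ)     A e = frame-arr ρ A (∨-conicalʳ (writesArr c A) _ e)
frame-arr (loop _ ρ ρ′)               A e = trans (frame-arr ρ′ A e) (frame-arr ρ A e)
frame-arr (exit _)                    A e = refl

Reaches : ∀ {k a} → List ℕ → Cmd k a → State k a → ℕ → (State k a → Set) → Set
Reaches inp c s T Q = ∃[ t ] ∃[ s′ ] (Run inp c s t s′ × t ≤ T × Q s′)

-- The index of the invariant is the exact number of iterations left, so it yields termination and
-- time together: `T` plus one test per iteration, and one final test.
while-rule : ∀ {k a inp b T} {c : Cmd k a} (I : ℕ → State k a → Set) →
             (∀ r s → I (suc r) s → Holds b s × Reaches inp c s T (I r)) →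
             (∀ s → I 0 s → ¬ Holds b s) →
             ∀ r s → I r s → Reaches inp (while b c) s (suc (r * suc T)) (I 0)
while-rule I body stop zero s i = 1 , s , exit (stop s i) , s≤s z≤n , i
while-rule {T = T} I body stop (suc r) s i with body r s i
... | h , t , s′ , ρ , t≤ , i′ with while-rule I body stop r s′ i′
...   | t′ , s″ , ρ′ , t′≤ , i″ =
  suc (t + t′) , s″ , loop h ρ ρ′ ,
  s≤s (≤-trans (+-mono-≤ t≤ t′≤) (≤-reflexive (+-suc T (r * suc T)))) , i″

-- Registers, tables and the code of the algorithm.

#regs #arrs : ℕ
#regs = 24
#arrs = 7

rKey rWin rEnd rTarget rZero rOne rN rM rN1 rMaj rG rI rSym rC₀ rC₁ rP rCols rNext rD rJ rEll rBest rH rT : Fin #regs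
rKey    = # 0
rWin    = # 1
rEnd    = # 2
rTarget = # 3
rZero   = # 4
rOne    = # 5
rN      = # 6
rM      = # 7
rN1     = # 8
rMaj    = # 9
rG      = # 10
rI      = # 11
rSym    = # 12
rC₀     = # 13
rC₁     = # 14
rP      = # 15
rCols   = # 16
rNext   = # 17
rD      = # 18
rJ      = # 19
rEll    = # 20
rBest   = # 21
rH      = # 22
rT      = # 23

aRank aKth aPrev aLen aG aH aLast : Fin #arrs
aRank = # 0
aKth  = # 1
aPrev = # 2
aLen  = # 3
aG    = # 4
aH    = # 5
aLast = # 6

-- `rKey` and `rEnd` receive sums of level 0 registers, and `rWin` copies of `rKey`. Only `rTarget`
-- receives a sum that involves one of these.
level : Fin #regs → ℕ
level zero                   = 1
level (suc zero)             = 1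
level (suc (suc zero))       = 1
level (suc (suc (suc zero))) = 2
level _                      = 0

Code : Set
Code = Cmd #regs #arrs

-- Harmless because `rSym` is always read afresh from the input before it is tested.
skip : Code
skip = basic (clear rSym)

countLoop countBody majority rankLoop rankBody ranks prevLoop prevBody prevs-table runLoop runBody run-table : Code

countBody =
  -- Cells 0 and 1 hold the lengths, so position `g` of x, counted from 1, is in cell `g + 1`.
  basic (incr rI rG) ⨾
  read rSym rI ⨾
  cond (equal rSym rZero) (basic (incr rC₀ rC₀)) (basic (incr rC₁ rC₁)) ⨾
  basic (minus rG rG rOne)

countLoop = while (less rZero rG) countBody

majority =
  basic (incr rOne rZero) ⨾
  basic (incr rN1 rN) ⨾
  basic (copy rG rN) ⨾
  countLoop ⨾
  cond (less rC₀ rC₁) (basic (copy rMaj rOne)) (basic (copy rMaj rZero))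

rankBody =
  basic (copy rI rG) ⨾
  basic (minus rG rG rOne) ⨾
  read rSym rI ⨾
  cond (equal rSym rMaj) skip (basic (incr rT rT) ⨾ basic (put aKth rT rG)) ⨾
  basic (put aRank rG rT)

rankLoop = while (less rZero rG) rankBody

ranks =
  basic (copy rG rN1) ⨾
  basic (clear rT) ⨾
  rankLoop

prevBody =
  basic (incr rI rG) ⨾
  read rSym rI ⨾
  cond (equal rSym rMaj) (basic (copy rT rG)) skip ⨾
  basic (incr rG rG) ⨾
  basic (put aPrev rG rT)

prevLoop = while (less rG rN1) prevBody

prevs-table =
  basic (clear rG) ⨾
  basic (clear rT) ⨾
  prevLoop

runBody =
  -- `rEnd` serves as the address register because a sum may not be put into a register of level 0.
  basic (plus rEnd rN1 rG) ⨾
  read rSym rEnd ⨾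
  cond (equal rSym rMaj)
    (basic (incr rP rP))
    (basic (get rT aLen rP) ⨾ basic (incr rT rT) ⨾ basic (put aLen rP rT)) ⨾
  basic (minus rG rG rOne)

runLoop = while (less rZero rG) runBody

run-table =
  basic (copy rG rM) ⨾
  runLoop

startLoop startBody windowLoop windowBody window-step window-output minority majorityLoop majorityBody majority-step rowLoop rowBody columns searchLoop searchBody search lcs-code : Code

startBody =
  basic (put aG rD rN1) ⨾
  -- Two increments per column make `rNext` twice the number of columns. Doubling it by a sum would
  -- be repeated, which the level discipline excludes.
  basic (incr rNext rNext) ⨾
  basic (incr rNext rNext) ⨾
  basic (incr rD rD)

startLoop = while (less rD rCols) startBody

window-step =
  cond (less rWin rKey) skip (basic (copy rWin rKey)) ⨾
  basic (put aLast rKey rD) ⨾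
  basic (get rBest aLast rWin) ⨾
  basic (plus rEnd rBest rEll) ⨾
  cond (less rEnd rD)
    (basic (incr rWin rWin) ⨾ basic (get rBest aLast rWin) ⨾ basic (plus rEnd rBest rEll))
    skip

window-output =
  cond (equal rEnd rD)
    (basic (get rH aG rBest))
    (basic (plus rTarget rWin rEll) ⨾ basic (minus rTarget rTarget rD) ⨾ basic (get rH aKth rTarget)) ⨾
  basic (put aH rD rH) ⨾
  basic (incr rD rD)

windowBody =
  (basic (get rG aG rD) ⨾
   basic (get rT aRank rG) ⨾
   basic (plus rKey rT rD)) ⨾
  window-step ⨾
  window-output

windowLoop = while (less rD rCols) windowBody

minority =
  basic (get rEll aLen rJ) ⨾
  -- A rank is at most `n + 1`, so the key of column 0 does not exceed this initial minimum.
  basic (copy rWin rN1) ⨾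
  basic (clear rD) ⨾
  windowLoop

majorityBody =
  basic (get rH aH rD) ⨾
  basic (get rG aPrev rH) ⨾
  cond (less rG rI) (basic (copy rG rI)) skip ⨾
  basic (put aG rD rG) ⨾
  basic (copy rI rH) ⨾
  basic (incr rD rD)

majorityLoop = while (less rD rCols) majorityBody

majority-step =
  basic (clear rD) ⨾
  basic (clear rI) ⨾
  majorityLoop

rowBody =
  basic (incr rJ rJ) ⨾
  majority-step ⨾
  minority

rowLoop = while (less rJ rP) rowBody

columns =
  basic (copy rCols rNext) ⨾
  basic (clear rNext) ⨾
  basic (clear rD) ⨾
  startLoop ⨾
  basic (clear rJ) ⨾
  minority ⨾
  rowLoop

searchBody =
  basic (incr rD rD) ⨾
  basic (get rH aH rD)

searchLoop = while (equal rH rZero) searchBody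

search =
  basic (clear rD) ⨾
  basic (get rH aH rD) ⨾
  searchLoop ⨾
  basic (minus rT rM rD)

lcs-code =
  majority ⨾
  ranks ⨾
  prevs-table ⨾
  run-table ⨾
  basic (clear rH) ⨾
  basic (copy rNext rOne) ⨾
  while (equal rH rZero) columns ⨾
  search

lcs-code-levelled : T (Levels.levelled level lcs-code)
lcs-code-levelled = tt

-- Correctness and running time of the program

cell-++ : ∀ us {vs} g → cell (us ++ vs) (length us + g) ≡ cell vs g
cell-++ []       g = refl
cell-++ (u ∷ us) g = cell-++ us g

cell-drop : ∀ (zs : BinString) {us} g {c r} → drop g zs ≡ c ∷ r → cell (map toℕ zs ++ us) g ≡ toℕ c
cell-drop (z ∷ zs) zero    refl = refl
cell-drop (z ∷ zs) (suc g) e    = cell-drop zs g e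

last-drop : ∀ {A : Set} (zs : List A) → drop (length zs) zs ≡ []
last-drop []       = refl
last-drop (z ∷ zs) = last-drop zs

hits≤ : ∀ Q g j → hits Q g j ≤ j
hits≤ Q g zero = z≤n
hits≤ Q g (suc j) with Q g
... | true  = s≤s (hits≤ Q (suc g) j)
... | false = m≤n⇒m≤1+n (hits≤ Q (suc g) j)

module Correctness (xs ys : BinString) where

  n m : ℕ
  n = length xs
  m = length ys

  inp : List ℕ
  inp = encodeInput xs ys

  length-inp : length inp ≡ 2 + (n + m)
  length-inp = cong (2 +_) (trans (length-++ (map toℕ xs)) (cong₂ _+_ (length-map toℕ xs) (length-map toℕ ys)))

  cell-x : ∀ g {c r} → drop g xs ≡ c ∷ r → cell inp (2 + g) ≡ toℕ c
  cell-x = cell-drop xs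

  cell-y : ∀ g {c r} → drop g ys ≡ c ∷ r → cell inp (2 + n + g) ≡ toℕ c
  cell-y g e = trans (cong (λ l → cell (map toℕ xs ++ map toℕ ys) (l + g)) (sym (length-map toℕ xs)))
    (trans (cell-++ (map toℕ xs) g)
      (trans (cong (λ us → cell us g) (sym (++-identityʳ (map toℕ ys)))) (cell-drop ys g e)))

  St : Set
  St = State #regs #arrs

  record Constants (Z : Fin 2) (z o a b a₁ k : ℕ) : Set where
    constructor constants
    field
      zero≡ : z ≡ 0
      one≡  : o ≡ 1
      n≡    : a ≡ n
      m≡    : b ≡ m
      n₁≡   : a₁ ≡ suc n
      maj≡  : k ≡ toℕ Z

  Consts : Fin 2 → St → Set
  Consts Z s = Constants Z (reg s rZero) (reg s rOne) (reg s rN) (reg s rM) (reg s rN1) (reg s rMaj)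

  const-regs : List (Fin #regs)
  const-regs = rZero ∷ rOne ∷ rN ∷ rM ∷ rN1 ∷ rMaj ∷ []

  keep-consts : ∀ {Z c s t s′} → Run inp c s t s′ → All (λ r → writesReg c r ≡ false) const-regs →
                Consts Z s → Consts Z s′
  keep-consts ρ (e₁ ∷ e₂ ∷ e₃ ∷ e₄ ∷ e₅ ∷ e₆ ∷ []) (constants z o a b a₁ k) = constants
    (trans (frame-reg ρ rZero e₁) z) (trans (frame-reg ρ rOne e₂) o) (trans (frame-reg ρ rN e₃) a)
    (trans (frame-reg ρ rM e₄) b) (trans (frame-reg ρ rN1 e₅) a₁) (trans (frame-reg ρ rMaj e₆) k)

  record Initial (s : St) : Set where
    field
      reg-n : reg s rN ≡ n
      reg-m : reg s rM ≡ m
      zero≡ : reg s rZero ≡ 0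
      c₀≡   : reg s rC₀ ≡ 0
      c₁≡   : reg s rC₁ ≡ 0
      p≡    : reg s rP ≡ 0
      arr≡  : ∀ A i → arr s A i ≡ 0

  module Majority where

    record Inv (r : ℕ) (s : St) : Set where
      field
        g≡    : reg s rG ≡ r
        r≤n   : r ≤ n
        zero≡ : reg s rZero ≡ 0
        one≡  : reg s rOne ≡ 1
        c₀≡   : reg s rC₀ ≡ count zero (drop r xs)
        c₁≡   : reg s rC₁ ≡ count (suc zero) (drop r xs)

    body : ∀ r s → Inv (suc r) s → Holds (less rZero rG) s × Reaches inp countBody s 5 (Inv r)
    body r s I = subst₂ _<_ (sym zero≡) (sym g≡) (s≤s z≤n) , go (drop-∷ xs r r≤n)
      where
      open Inv I
      address≡ : suc (reg s rG) ≡ 2 + r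
      address≡ = cong suc g≡
      address< : suc (reg s rG) < length inp
      address< = subst₂ _<_ (sym address≡) (sym length-inp) (s≤s (s≤s (≤-trans r≤n (m≤m+n n m))))
      dec≡ : reg s rG ∸ reg s rOne ≡ r
      dec≡ = cong₂ _∸_ g≡ one≡
      go : ∃[ c ] (drop r xs ≡ c ∷ drop (suc r) xs) → Reaches inp countBody s 5 (Inv r)
      go (zero , e) = _ , _ ,
        (basic ⨾ read address< ⨾
         ifTrue (trans (cong (cell inp) address≡) (trans (cell-x r e) (sym zero≡))) basic ⨾ basic) , ≤-refl ,
        record { g≡ = dec≡ ; r≤n = <⇒≤ r≤n ; zero≡ = zero≡ ; one≡ = one≡
               ; c₀≡ = trans (cong suc c₀≡) (cong (count zero) (sym e))
               ; c₁≡ = trans c₁≡ (cong (count (suc zero)) (sym e)) }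
      go (suc zero , e) = _ , _ ,
        (basic ⨾ read address< ⨾
         ifFalse (λ h → 1+n≢0 (trans (sym (trans (cong (cell inp) address≡) (cell-x r e))) (trans h zero≡))) basic ⨾
         basic) , ≤-refl ,
        record { g≡ = dec≡ ; r≤n = <⇒≤ r≤n ; zero≡ = zero≡ ; one≡ = one≡
               ; c₀≡ = trans c₀≡ (cong (count zero) (sym e))
               ; c₁≡ = trans (cong suc c₁≡) (cong (count (suc zero)) (sym e)) }

    stop : ∀ s → Inv 0 s → ¬ Holds (less rZero rG) s
    stop s I h = n≮0 (subst (reg s rZero <_) (Inv.g≡ I) h)

    correct : ∀ s → Initial s → Reaches inp majority s (6 + n * 6) (λ s′ → ∃[ Z ] (Consts Z s′ × n ≤ 2 * count Z xs))
    correct s I with while-rule Inv body stop n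
      (eval (copy rG rN) (eval (incr rN1 rN) (eval (incr rOne rZero) s)))
      (record { g≡ = reg-n ; r≤n = ≤-refl ; zero≡ = zero≡ ; one≡ = cong suc zero≡
              ; c₀≡ = trans c₀≡ (cong (count zero) (sym (last-drop xs)))
              ; c₁≡ = trans c₁≡ (cong (count (suc zero)) (sym (last-drop xs))) })
      where open Initial I
    ... | t , s′ , ρ , t≤ , J with reg s′ rC₀ <? reg s′ rC₁
    ...   | yes <₁ = _ , _ , (basic ⨾ basic ⨾ basic ⨾ ρ ⨾ ifTrue <₁ basic) ,
      s≤s (s≤s (s≤s (≤-trans (+-monoˡ-≤ 2 t≤) (≤-reflexive (+-comm (suc (n * 6)) 2))))) ,
      suc zero , constants (Inv.zero≡ J) (Inv.one≡ J) (trans (frame-reg ρ rN refl) (Initial.reg-n I))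
        (trans (frame-reg ρ rM refl) (Initial.reg-m I))
        (trans (frame-reg ρ rN1 refl) (cong suc (Initial.reg-n I))) (Inv.one≡ J) ,
      ≤-trans (≤-reflexive (sym (count-total xs)))
        (≤-trans (+-monoˡ-≤ (count (suc zero) xs) (<⇒≤ (subst₂ _<_ (Inv.c₀≡ J) (Inv.c₁≡ J) <₁)))
          (≤-reflexive (cong (count (suc zero) xs +_) (sym (+-identityʳ _)))))
    ...   | no ≮₁ = _ , _ , (basic ⨾ basic ⨾ basic ⨾ ρ ⨾ ifFalse ≮₁ basic) ,
      s≤s (s≤s (s≤s (≤-trans (+-monoˡ-≤ 2 t≤) (≤-reflexive (+-comm (suc (n * 6)) 2))))) ,
      zero , constants (Inv.zero≡ J) (Inv.one≡ J) (trans (frame-reg ρ rN refl) (Initial.reg-n I))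
        (trans (frame-reg ρ rM refl) (Initial.reg-m I))
        (trans (frame-reg ρ rN1 refl) (cong suc (Initial.reg-n I))) (Inv.zero≡ J) ,
      ≤-trans (≤-reflexive (sym (count-total xs)))
        (≤-trans (+-monoʳ-≤ (count zero xs) (subst₂ _≤_ (Inv.c₁≡ J) (Inv.c₀≡ J) (≮⇒≥ ≮₁)))
          (≤-reflexive (cong (count zero xs +_) (sym (+-identityʳ _)))))

  put-entry : ∀ (f F : ℕ → ℕ) {a r v} → a ≡ r → v ≡ F r → ∀ q → (q ≢ r → f q ≡ F q) → (f [ a ≔ v ]) q ≡ F q
  put-entry f F {a} {_} {v} refl v≡ q old with q ≟ a
  ... | yes refl = trans ([≔]-same f a v) v≡
  ... | no q≢a   = trans ([≔]-other f a v q (λ e → q≢a (sym e))) (old q≢a)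

  ≡⇒≡ᵇ-true : ∀ {a b} → a ≡ b → (a ≡ᵇ b) ≡ true
  ≡⇒≡ᵇ-true {a} {b} a≡b with a ≡ᵇ b in e
  ... | true  = refl
  ... | false = contradiction (≡⇒≡ᵇ a b a≡b) (subst T e)

  ≢⇒≡ᵇ-false : ∀ {a b} → a ≢ b → (a ≡ᵇ b) ≡ false
  ≢⇒≡ᵇ-false {a} {b} a≢b with a ≡ᵇ b in e
  ... | false = refl
  ... | true  = contradiction (≡ᵇ⇒≡ a b (subst T (sym e) tt)) a≢b

  -- The cell before the first symbol of x gives position 0 an arbitrary colour,
  -- which nothing depends on.
  module WithMajority (Z : Fin 2) where

    isZ isO : ℕ → Bool
    isZ g = cell inp (suc g) ≡ᵇ toℕ Z
    isO = hit isZ false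

    reads : ∀ g {c r} → drop g xs ≡ c ∷ r → isZ (suc g) ≡ isSymbol Z c
    reads g e = cong (_≡ᵇ toℕ Z) (cell-x g e)

    RankTable KthTable PrevTable : (ℕ → ℕ) → Set
    RankTable f = ∀ g → g ≤ suc n → f g ≡ rank isO n g
    KthTable f = ∀ t → 1 ≤ t → f t ≡ kth isO n t
    PrevTable f = ∀ g → g ≤ suc n → f g ≡ prev isZ g

    -- Tables computed once from x and y.

    module Ranks where

      record Inv (r : ℕ) (s : St) : Set where
        field
          consts : Consts Z s
          g≡     : reg s rG ≡ r
          r≤     : r ≤ suc n
          t≡     : reg s rT ≡ rank isO n r
          ranks≡ : ∀ q → r ≤ q → q ≤ suc n → arr s aRank q ≡ rank isO n q
          kths≡  : ∀ t → 1 ≤ t → t ≤ rank isO n r → arr s aKth t ≡ kth isO n t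
          rest≡  : ∀ t → rank isO n r < t → arr s aKth t ≡ 0

      body : ∀ r s → Inv (suc r) s → Holds (less rZero rG) s × Reaches inp rankBody s 7 (Inv r)
      body r s I = subst₂ _<_ (sym zero≡) (sym g≡) (s≤s z≤n) , go
        where
        open Inv I
        open Constants consts
        address< : reg s rG < length inp
        address< = subst₂ _<_ (sym g≡) (sym length-inp) (s≤s (≤-trans r≤ (s≤s (m≤m+n n m))))
        dec≡ : reg s rG ∸ reg s rOne ≡ r
        dec≡ = cong₂ _∸_ g≡ one≡
        here = rank-here isO (≤-pred r≤)
        below : ∀ {f v} → v ≡ rank isO n r → (∀ q → suc r ≤ q → q ≤ suc n → f q ≡ rank isO n q) →
                ∀ q → r ≤ q → q ≤ suc n → (f [ reg s rG ∸ reg s rOne ≔ v ]) q ≡ rank isO n q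
        below {f} v≡ old q r≤q q≤ = put-entry f (rank isO n) dec≡ v≡ q (λ q≢r → old q (≤∧≢⇒< r≤q (λ e → q≢r (sym e))) q≤)
        go : Reaches inp rankBody s 7 (Inv r)
        go with cell inp (reg s rG) ≟ reg s rMaj
        ... | yes sym≡ = _ , _ , (basic ⨾ basic ⨾ read address< ⨾ ifTrue sym≡ basic ⨾ basic) , n≤1+n 6 ,
          record { consts = consts ; g≡ = dec≡ ; r≤ = <⇒≤ r≤ ; t≡ = rank≡
                 ; ranks≡ = below rank≡ ranks≡
                 ; kths≡ = λ t 1≤t t≤ → kths≡ t 1≤t (subst (t ≤_) (sym same) t≤)
                 ; rest≡ = λ t t> → rest≡ t (subst (_< t) (sym same) t>) }
          where
          colour : isO r ≡ false
          colour = cong not (≡⇒≡ᵇ-true (trans (cong (cell inp) (sym g≡)) (trans sym≡ maj≡)))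
          same : rank isO n (suc r) ≡ rank isO n r
          same = sym (trans here (cong (λ b → if b then suc (rank isO n (suc r)) else rank isO n (suc r)) colour))
          rank≡ = trans t≡ same
        ... | no sym≢ = _ , _ , (basic ⨾ basic ⨾ read address< ⨾ ifFalse sym≢ (basic ⨾ basic) ⨾ basic) , ≤-refl ,
          record { consts = consts ; g≡ = dec≡ ; r≤ = <⇒≤ r≤ ; t≡ = rank≡
                 ; ranks≡ = below rank≡ ranks≡
                 ; kths≡ = λ t 1≤t t≤ → put-entry (arr s aKth) (kth isO n) rank≡ (trans dec≡ found) t
                     (λ t≢ → kths≡ t 1≤t (≤-pred (subst (t <_) (sym next) (≤∧≢⇒< t≤ t≢))))
                 ; rest≡ = λ t t> → trans ([≔]-other (arr s aKth) _ _ t (λ e → <⇒≢ t> (trans (sym rank≡) e)))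
                     (rest≡ t (<-trans ≤-refl (subst (_< t) (sym next) t>))) }
          where
          colour : isO r ≡ true
          colour = cong not (≢⇒≡ᵇ-false (λ e → sym≢ (trans (cong (cell inp) g≡) (trans e (sym maj≡)))))
          next : suc (rank isO n (suc r)) ≡ rank isO n r
          next = sym (trans here (cong (λ b → if b then suc (rank isO n (suc r)) else rank isO n (suc r)) colour))
          rank≡ = trans (cong suc t≡) next
          found : r ≡ kth isO n (rank isO n r)
          found = trans (cong (λ b → if b then r else prev isO r) (sym colour))
                    (trans (prev-kth isO n r≤) (cong (kth isO n) next))

      stop : ∀ s → Inv 0 s → ¬ Holds (less rZero rG) s
      stop s I h = n≮0 (subst (reg s rZero <_) (Inv.g≡ I) h)

      correct : ∀ s → Consts Z s → (∀ A i → arr s A i ≡ 0) →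
                Reaches inp ranks s (3 + suc n * 8) (λ s′ → RankTable (arr s′ aRank) × KthTable (arr s′ aKth))
      correct s C arr≡ with while-rule Inv body stop (suc n) (eval (clear rT) (eval (copy rG rN1) s))
        (record { consts = C ; g≡ = Constants.n₁≡ C ; r≤ = ≤-refl ; t≡ = sym (rank-top isO n)
                ; ranks≡ = λ q ≤q q≤ → trans (arr≡ aRank q)
                    (trans (sym (rank-top isO n)) (cong (rank isO n) (≤-antisym ≤q q≤)))
                ; kths≡ = λ t 1≤t t≤ → contradiction (≤-trans 1≤t (subst (t ≤_) (rank-top isO n) t≤)) λ ()
                ; rest≡ = λ t _ → arr≡ aKth t })
      ... | t , s′ , ρ , t≤ , J = _ , _ , (basic ⨾ basic ⨾ ρ) , s≤s (s≤s t≤) ,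
        (λ g → Inv.ranks≡ J g z≤n) , kths
        where
        kths : KthTable (arr s′ aKth)
        kths u 1≤u with u ≤? rank isO n 0
        ... | yes u≤ = Inv.kths≡ J u 1≤u u≤
        -- Beyond the last hit `kth` is 0, which is what the entry still contains from the start.
        ... | no u≰ = trans (Inv.rest≡ J u (≰⇒> u≰)) (sym (n≤0⇒n≡0
          (≤-trans (kth-antitone isO n (≰⇒> u≰)) (≤-reflexive (sym (prev-kth isO n {0} z≤n))))))

    module Prevs where

      record Inv (r : ℕ) (s : St) : Set where
        field
          consts : Consts Z s
          g+r    : reg s rG + r ≡ suc n
          t≡     : reg s rT ≡ prev isZ (reg s rG)
          prevs≡ : ∀ q → q ≤ reg s rG → arr s aPrev q ≡ prev isZ q

      body : ∀ r s → Inv (suc r) s → Holds (less rG rN1) s × Reaches inp prevBody s 6 (Inv r)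
      body r s I = subst (g <_) (sym n₁≡) g< , go
        where
        open Inv I
        open Constants consts
        g = reg s rG
        g< : g < suc n
        g< = ≤-trans (m≤m+n (suc g) r) (≤-reflexive (trans (sym (+-suc g r)) g+r))
        address< : suc g < length inp
        address< = subst (suc g <_) (sym length-inp) (s≤s (≤-trans g< (s≤s (m≤m+n n m))))
        above : ∀ {f v} → v ≡ prev isZ (suc g) → (∀ q → q ≤ g → f q ≡ prev isZ q) →
                ∀ q → q ≤ suc g → (f [ suc g ≔ v ]) q ≡ prev isZ q
        above {f} v≡ old q q≤ = put-entry f (prev isZ) refl v≡ q (λ q≢ → old q (≤-pred (≤∧≢⇒< q≤ q≢)))
        go : Reaches inp prevBody s 6 (Inv r)
        go with cell inp (suc g) ≟ reg s rMaj
        ... | yes sym≡ = _ , _ , (basic ⨾ read address< ⨾ ifTrue sym≡ basic ⨾ basic ⨾ basic) , ≤-refl ,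
          record { consts = consts ; g+r = trans (sym (+-suc g r)) g+r ; t≡ = here ; prevs≡ = above here prevs≡ }
          where
          here : g ≡ prev isZ (suc g)
          here = cong (λ b → if b then g else prev isZ g) (sym (≡⇒≡ᵇ-true (trans sym≡ maj≡)))
        ... | no sym≢ = _ , _ , (basic ⨾ read address< ⨾ ifFalse sym≢ basic ⨾ basic ⨾ basic) , ≤-refl ,
          record { consts = consts ; g+r = trans (sym (+-suc g r)) g+r ; t≡ = here ; prevs≡ = above here prevs≡ }
          where
          here : reg s rT ≡ prev isZ (suc g)
          here = trans t≡ (cong (λ b → if b then g else prev isZ g)
                   (sym (≢⇒≡ᵇ-false (λ e → sym≢ (trans e (sym maj≡))))))

      stop : ∀ s → Inv 0 s → ¬ Holds (less rG rN1) s
      stop s I h = <⇒≢ h (trans (trans (sym (+-identityʳ _)) (Inv.g+r I)) (sym (Constants.n₁≡ (Inv.consts I))))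

      correct : ∀ s → Consts Z s → (∀ i → arr s aPrev i ≡ 0) →
                Reaches inp prevs-table s (3 + suc n * 7) (λ s′ → PrevTable (arr s′ aPrev))
      correct s C arr≡ with while-rule Inv body stop (suc n) (eval (clear rT) (eval (clear rG) s))
        (record { consts = C ; g+r = refl ; t≡ = refl
                ; prevs≡ = λ q q≤ → trans (arr≡ q) (cong (prev isZ) (sym (n≤0⇒n≡0 q≤))) })
      ... | t , s′ , ρ , t≤ , J = _ , _ , (basic ⨾ basic ⨾ ρ) , s≤s (s≤s t≤) ,
        λ g g≤ → Inv.prevs≡ J g (≤-trans g≤ (≤-reflexive (trans (sym (Inv.g+r J)) (+-identityʳ _))))

    RunTable : (ℕ → ℕ) → ℕ → BinString → Set
    RunTable len p zs = map (isSymbol Z) zs ≡ runs len p × p ≡ count Z zs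

    module Runs where

      record Inv (r : ℕ) (s : St) : Set where
        field
          consts : Consts Z s
          g≡     : reg s rG ≡ r
          r≤m    : r ≤ m
          table  : RunTable (arr s aLen) (reg s rP) (drop r ys)
          unused : ∀ j → reg s rP < j → arr s aLen j ≡ 0

      body : ∀ r s → Inv (suc r) s → Holds (less rZero rG) s × Reaches inp runBody s 7 (Inv r)
      body r s I = subst₂ _<_ (sym zero≡) (sym g≡) (s≤s z≤n) , go (drop-∷ ys r r≤m)
        where
        open Inv I
        open Constants consts
        address≡ : reg s rN1 + reg s rG ≡ 2 + n + r
        address≡ = trans (cong₂ _+_ n₁≡ g≡) (+-suc (suc n) r)
        address< : reg s rN1 + reg s rG < length inp
        address< = subst₂ _<_ (sym address≡) (sym length-inp) (+-monoʳ-< (2 + n) r≤m)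
        dec≡ : reg s rG ∸ reg s rOne ≡ r
        dec≡ = cong₂ _∸_ g≡ one≡
        go : ∃[ c ] (drop r ys ≡ c ∷ drop (suc r) ys) → Reaches inp runBody s 7 (Inv r)
        go (c , e) with c ≟ᶠ Z
        ... | yes refl = _ , _ ,
          (basic ⨾ read address< ⨾
           ifTrue (trans (cong (cell inp) address≡) (trans (cell-y r e) (sym maj≡))) basic ⨾ basic) ,
          m≤n+m 5 2 ,
          record { consts = consts ; g≡ = dec≡ ; r≤m = <⇒≤ r≤m
                 ; table = trans (cong (map (isSymbol c)) e)
                             (trans (cong₂ _∷_ (≡⇒≡ᵇ-true {toℕ c} refl) (proj₁ table))
                               -- The majority symbol opens a new run, whose length entry is still
                               -- the initial 0.
                               (cong (λ l → replicate l false ++ separated (arr s aLen) (suc (reg s rP)))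
                                 (sym (unused _ ≤-refl))))
                         , trans (cong suc (proj₂ table)) (sym (trans (cong (count c) e) (count-same c _)))
                 ; unused = λ j p<j → unused j (<-trans ≤-refl p<j) }
        ... | no c≢Z = _ , _ ,
          (basic ⨾ read address< ⨾
           ifFalse (λ h → c≢Z (toℕ-injective (trans (sym (trans (cong (cell inp) address≡) (cell-y r e))) (trans h maj≡))))
             (basic ⨾ basic ⨾ basic) ⨾ basic) ,
          ≤-refl ,
          record { consts = consts ; g≡ = dec≡ ; r≤m = <⇒≤ r≤m
                 ; table = trans (cong (map (isSymbol Z)) e)
                             (trans (cong₂ _∷_ (≢⇒≡ᵇ-false (λ h → c≢Z (toℕ-injective h))) (proj₁ table))
                               (sym (runs-extend (arr s aLen) (reg s rP))))
                         , trans (proj₂ table) (sym (trans (cong (count Z) e) (count-other _ c≢Z)))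
                 ; unused = λ j p<j → trans ([≔]-other (arr s aLen) _ _ j (<⇒≢ p<j)) (unused j p<j) }

      stop : ∀ s → Inv 0 s → ¬ Holds (less rZero rG) s
      stop s I h = n≮0 (subst (reg s rZero <_) (Inv.g≡ I) h)

      correct : ∀ s → Consts Z s → reg s rP ≡ 0 → (∀ i → arr s aLen i ≡ 0) →
                Reaches inp run-table s (2 + m * 8) (λ s′ → RunTable (arr s′ aLen) (reg s′ rP) ys)
      correct s C p≡ arr≡ with while-rule Inv body stop m (eval (copy rG rM) s)
        (record { consts = C ; g≡ = Constants.m≡ C ; r≤m = ≤-refl
                ; table = subst (RunTable (arr s aLen) (reg s rP)) (sym (last-drop ys)) (empty (reg s rP) p≡)
                ; unused = λ j _ → arr≡ j })
        where
        empty : ∀ p → p ≡ 0 → RunTable (arr s aLen) p []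
        empty _ refl = cong (λ l → replicate l false ++ []) (sym (arr≡ 0)) , refl
      ... | t , s′ , ρ , t≤ , J = _ , _ , (basic ⨾ ρ) , s≤s t≤ , Inv.table J

    -- Computation of the reach table row by row.

    module Rows (p : ℕ) (len : ℕ → ℕ) where

      -- `S j` is the row before the run with index `j` is put in front, `R j` the row after it;
      -- `aG` and `aH` hold these two.
      R S : ℕ → ℕ → ℕ
      R j = reach isZ n (runs len j)
      S j = reach isZ n (separated len j)

      record TableValues (α β γ ℓ : ℕ → ℕ) (q : ℕ) : Set where
        constructor tables
        field
          ranks≡ : RankTable α
          kths≡  : KthTable β
          prevs≡ : PrevTable γ
          len≡   : ∀ j → ℓ j ≡ len j
          p≡     : q ≡ p

      Tables : St → Set
      Tables s = TableValues (arr s aRank) (arr s aKth) (arr s aPrev) (arr s aLen) (reg s rP)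

      keep-tables : ∀ {c s t s′} → Run inp c s t s′ →
        All (λ A → writesArr c A ≡ false) (aRank ∷ aKth ∷ aPrev ∷ aLen ∷ []) → writesReg c rP ≡ false →
        Tables s → Tables s′
      keep-tables ρ (e₁ ∷ e₂ ∷ e₃ ∷ e₄ ∷ []) e (tables r k v l q) = tables
        (subst RankTable (sym (frame-arr ρ aRank e₁)) r) (subst KthTable (sym (frame-arr ρ aKth e₂)) k)
        (subst PrevTable (sym (frame-arr ρ aPrev e₃)) v)
        (λ j → trans (cong (λ f → f j) (frame-arr ρ aLen e₄)) (l j)) (trans (frame-reg ρ rP e) q)

      Entries : ℕ → (ℕ → ℕ) → (ℕ → ℕ) → Set
      Entries N f F = ∀ d → d < N → f d ≡ F d

      add-entry : ∀ (f F : ℕ → ℕ) {d v} → v ≡ F d → Entries d f F → Entries (suc d) (f [ d ≔ v ]) F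
      add-entry f F v≡ old q q< = put-entry f F refl v≡ q (λ q≢ → old q (≤∧≢⇒< (≤-pred q<) q≢))

      not-full : ∀ {d r N} → d + suc r ≡ N → d < N
      not-full {d} {r} e = ≤-trans (m≤m+n (suc d) r) (≤-reflexive (trans (sym (+-suc d r)) e))

      advance : ∀ {d r N} → d + suc r ≡ N → suc d + r ≡ N
      advance {d} {r} e = trans (sym (+-suc d r)) e

      full : ∀ {d N} → d + 0 ≡ N → d ≡ N
      full e = trans (sym (+-identityʳ _)) e

      module Minority (j N : ℕ) where

        open Run-of-minority isZ n (separated len j)

        ℓ : ℕ
        ℓ = len j

        record Inv (r : ℕ) (s : St) : Set where
          field
            consts : Consts Z s
            tabs   : Tables s
            d+r    : reg s rD + r ≡ N
            cols≡  : reg s rCols ≡ N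
            ell≡   : reg s rEll ≡ ℓ
            gs     : Entries N (arr s aG) (S j)
            hs     : Entries (reg s rD) (arr s aH) (R j)
            window : Window ℓ (reg s rD) (reg s rWin) (arr s aLast)
            h≡     : ∀ d → reg s rD ≡ suc d → reg s rH ≡ R j d

        step-correct : ∀ s → reg s rKey ≡ key (reg s rD) → reg s rEll ≡ ℓ →
          Window ℓ (reg s rD) (reg s rWin) (arr s aLast) →
          Reaches inp window-step s 9 (λ s′ → Settled ℓ (reg s rD) (reg s′ rWin) (arr s′ aLast) ×
            reg s′ rBest ≡ arr s′ aLast (reg s′ rWin) × reg s′ rEnd ≡ reg s′ rBest + ℓ)
        step-correct s key≡ ell≡ W with reg s rWin <? reg s rKey
        -- The minimum has just been attained in column `d` itself, so it cannot have expired.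
        ... | no W≮ = _ , _ , (ifFalse W≮ basic ⨾ basic ⨾ basic ⨾ basic ⨾ ifFalse (≤⇒≯ fresh′) basic) , m≤m+n 7 2 ,
          settled , refl , cong (_ +_) ell≡
          where
          settled = settle-drop key≡ W (≮⇒≥ W≮)
          fresh′ = subst (λ e → reg s rD ≤ (arr s aLast [ reg s rKey ≔ reg s rD ]) (reg s rKey) + e) (sym ell≡)
                     (Settled.fresh settled)
        ... | yes W< with (arr s aLast [ reg s rKey ≔ reg s rD ]) (reg s rWin) + reg s rEll <? reg s rD
        ...   | no alive = _ , _ , (ifTrue W< basic ⨾ basic ⨾ basic ⨾ basic ⨾ ifFalse alive basic) , m≤m+n 7 2 ,
          settle-keep key≡ W W< (subst (λ e → reg s rD ≤ (arr s aLast [ reg s rKey ≔ reg s rD ]) (reg s rWin) + e)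
            ell≡ (≮⇒≥ alive)) , refl , cong (_ +_) ell≡
        ...   | yes expired = _ , _ ,
          (ifTrue W< basic ⨾ basic ⨾ basic ⨾ basic ⨾ ifTrue expired (basic ⨾ basic ⨾ basic)) , ≤-refl ,
          settle-expire key≡ W W< (subst (λ e → (arr s aLast [ reg s rKey ≔ reg s rD ]) (reg s rWin) + e < reg s rD)
            ell≡ expired) , refl , cong (_ +_) ell≡

        output-correct : ∀ r s → Consts Z s → Tables s → reg s rD + suc r ≡ N → reg s rCols ≡ N → reg s rEll ≡ ℓ →
          Entries N (arr s aG) (S j) → Entries (reg s rD) (arr s aH) (R j) →
          Settled ℓ (reg s rD) (reg s rWin) (arr s aLast) →
          reg s rBest ≡ arr s aLast (reg s rWin) → reg s rEnd ≡ reg s rBest + ℓ →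
          Reaches inp window-output s 6 (Inv r)
        output-correct r s consts tabs d+r cols≡ ell≡ gs hs settled best≡ end≡ = go
          where
          d = reg s rD
          end≡′ : reg s rEnd ≡ arr s aLast (reg s rWin) + ℓ
          end≡′ = trans end≡ (cong (_+ ℓ) best≡)
          inv : ∀ {s′ v} → Consts Z s′ → Tables s′ → reg s′ rD ≡ suc d → reg s′ rCols ≡ N → reg s′ rEll ≡ ℓ →
                arr s′ aG ≡ arr s aG → arr s′ aH ≡ arr s aH [ d ≔ v ] → reg s′ rH ≡ v →
                arr s′ aLast ≡ arr s aLast → reg s′ rWin ≡ reg s rWin → v ≡ R j d → Inv r s′
          inv {s′} C T d≡ N≡ ℓ≡ g≡ h≡ v≡ last≡ win≡ value = record
            { consts = C ; tabs = T ; d+r = trans (cong (_+ r) d≡) (advance d+r) ; cols≡ = N≡ ; ell≡ = ℓ≡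
            ; gs = λ e e< → trans (cong (λ f → f e) g≡) (gs e e<)
            ; hs = subst₂ (λ k f → Entries k f (R j)) (sym d≡) (sym h≡) (add-entry (arr s aH) (R j) value hs)
            ; window = subst (λ k → Window ℓ k (reg s′ rWin) (arr s′ aLast)) (sym d≡)
                (subst₂ (Window ℓ (suc d)) (sym win≡) (sym last≡) (window-next settled))
            ; h≡ = λ e e≡ → trans v≡ (trans value (cong (R j) (suc-injective (trans (sym d≡) e≡))))
            }
          go : Reaches inp window-output s 6 (Inv r)
          go with reg s rEnd ≟ d
          ... | yes end≡d = _ , _ , (ifTrue end≡d basic ⨾ basic ⨾ basic) , m≤m+n 4 2 ,
            inv consts tabs refl cols≡ ell≡ refl refl refl refl refl
              (trans (gs _ (≤-<-trans best≤ (not-full d+r)))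
                (trans (cong (S j) best≡) (sym (settled-exact settled (trans (sym end≡′) end≡d)))))
            where
            best≤ : reg s rBest ≤ d
            best≤ = subst (_≤ d) (sym best≡) (settled-best≤ settled)
          ... | no end≢d = _ , _ , (ifFalse end≢d (basic ⨾ basic ⨾ basic) ⨾ basic ⨾ basic) , ≤-refl ,
            inv consts tabs refl cols≡ ell≡ refl refl refl refl refl
              (trans (cong (λ e → arr s aKth (reg s rWin + e ∸ d)) ell≡)
                (trans (TableValues.kths≡ tabs _ (settled-target settled d<))
                  (sym (settled-kth settled d<))))
            where
            d< : d < arr s aLast (reg s rWin) + ℓ
            d< = ≤∧≢⇒< (Settled.fresh settled) (λ e → end≢d (trans end≡′ (sym e)))

        body : ∀ r s → Inv (suc r) s → Holds (less rD rCols) s × Reaches inp windowBody s 18 (Inv r)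
        body r s I = subst (reg s rD <_) (sym cols≡) (not-full d+r) , go
          where
          open Inv I
          d = reg s rD
          g≡ : arr s aG d ≡ S j d
          g≡ = gs d (not-full d+r)
          key≡ : arr s aRank (arr s aG d) + d ≡ key d
          key≡ = cong (_+ d) (trans (TableValues.ranks≡ tabs _ (subst (_≤ suc n) (sym g≡) (reach≤ isZ n (separated len j) d)))
                                    (cong (rank isO n) g≡))
          s₁ : St
          s₁ = eval (plus rKey rT rD) (eval (get rT aRank rG) (eval (get rG aG rD) s))
          go : Reaches inp windowBody s 18 (Inv r)
          go =
            let t₂ , s₂ , ρ₂ , t₂≤ , settled , best≡ , end≡ = step-correct s₁ key≡ ell≡ window
                d≡ = frame-reg ρ₂ rD refl
                t₃ , s₃ , ρ₃ , t₃≤ , I′ = output-correct r s₂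
                   (keep-consts ρ₂ (refl ∷ refl ∷ refl ∷ refl ∷ refl ∷ refl ∷ []) consts)
                   (keep-tables ρ₂ (refl ∷ refl ∷ refl ∷ refl ∷ []) refl tabs)
                   (trans (cong (_+ suc r) d≡) d+r)
                   (trans (frame-reg ρ₂ rCols refl) cols≡) (trans (frame-reg ρ₂ rEll refl) ell≡)
                   (subst (λ f → Entries N f (S j)) (sym (frame-arr ρ₂ aG refl)) gs)
                   (subst₂ (λ k f → Entries k f (R j)) (sym d≡) (sym (frame-arr ρ₂ aH refl)) hs)
                   (subst (λ k → Settled ℓ k (reg s₂ rWin) (arr s₂ aLast)) (sym d≡) settled) best≡ end≡
            in _ , s₃ , ((basic ⨾ basic ⨾ basic) ⨾ ρ₂ ⨾ ρ₃) , +-monoʳ-≤ 3 (+-mono-≤ t₂≤ t₃≤) , I′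

        stop : ∀ s → Inv 0 s → ¬ Holds (less rD rCols) s
        stop s I h = <⇒≢ h (trans (full (Inv.d+r I)) (sym (Inv.cols≡ I)))

        correct : ∀ s → Consts Z s → Tables s → reg s rJ ≡ j → reg s rCols ≡ N → Entries N (arr s aG) (S j) →
                  Reaches inp minority s (4 + N * 19) (λ s′ →
                    Entries N (arr s′ aH) (R j) × (∀ d → N ≡ suc d → reg s′ rH ≡ R j d))
        correct s C T j≡ N≡ gs =
          let t , s′ , ρ , t≤ , J = while-rule Inv body stop N
                (eval (clear rD) (eval (copy rWin rN1) (eval (get rEll aLen rJ) s)))
                (record { consts = C ; tabs = T ; d+r = refl ; cols≡ = N≡
                        ; ell≡ = trans (TableValues.len≡ T _) (cong len j≡)
                        ; gs = gs ; hs = λ _ () ; h≡ = λ _ ()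
                        ; window = window-start ℓ (reg s rN1) (arr s aLast)
                            (≤-trans (≤-reflexive (+-identityʳ _))
                              (≤-trans (hits≤ isO _ (suc n ∸ S j 0))
                                (≤-trans (m∸n≤m (suc n) (S j 0)) (≤-reflexive (sym (Constants.n₁≡ C)))))) })
          in _ , s′ , (basic ⨾ basic ⨾ basic ⨾ ρ) , s≤s (s≤s (s≤s t≤)) ,
          subst (λ k → Entries k (arr s′ aH) (R j)) (full (Inv.d+r J)) (Inv.hs J) ,
          λ d N≡ → Inv.h≡ J d (trans (full (Inv.d+r J)) N≡)

      module MajorityStep (j N : ℕ) where

        -- The value 0 for the missing column to the left is neutral for the maximum, which merges
        -- the two clauses of `reach` into one.
        preceding : ℕ → ℕ
        preceding zero    = 0
        preceding (suc d) = R j d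

        S-suc : ∀ d → S (suc j) d ≡ preceding d ⊔ prev isZ (R j d)
        S-suc zero    = refl
        S-suc (suc d) = refl

        record Inv (r : ℕ) (s : St) : Set where
          field
            consts : Consts Z s
            tabs   : Tables s
            d+r    : reg s rD + r ≡ N
            cols≡  : reg s rCols ≡ N
            hs     : Entries N (arr s aH) (R j)
            gs     : Entries (reg s rD) (arr s aG) (S (suc j))
            i≡     : reg s rI ≡ preceding (reg s rD)

        body : ∀ r s → Inv (suc r) s → Holds (less rD rCols) s × Reaches inp majorityBody s 7 (Inv r)
        body r s I = subst (reg s rD <_) (sym cols≡) (not-full d+r) , go
          where
          open Inv I
          d = reg s rD
          h≡ : arr s aH d ≡ R j d
          h≡ = hs d (not-full d+r)
          g≡ : arr s aPrev (arr s aH d) ≡ prev isZ (R j d)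
          g≡ = trans (TableValues.prevs≡ tabs _ (subst (_≤ suc n) (sym h≡) (reach≤ isZ n (runs len j) d)))
                     (cong (prev isZ) h≡)
          extend : ∀ {v} → v ≡ reg s rI ⊔ arr s aPrev (arr s aH d) →
                Entries (suc d) (arr s aG [ d ≔ v ]) (S (suc j))
          extend v≡ = add-entry (arr s aG) (S (suc j)) (trans v≡ (trans (cong₂ _⊔_ i≡ g≡) (sym (S-suc d)))) gs
          go : Reaches inp majorityBody s 7 (Inv r)
          go with arr s aPrev (arr s aH d) <? reg s rI
          ... | yes g<i = _ , _ , (basic ⨾ basic ⨾ ifTrue g<i basic ⨾ basic ⨾ basic ⨾ basic) , ≤-refl ,
            record { consts = consts ; tabs = tabs ; d+r = advance d+r ; cols≡ = cols≡ ; hs = hs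
                   ; gs = extend (sym (m≥n⇒m⊔n≡m (<⇒≤ g<i))) ; i≡ = h≡ }
          ... | no g≮i = _ , _ , (basic ⨾ basic ⨾ ifFalse g≮i basic ⨾ basic ⨾ basic ⨾ basic) , ≤-refl ,
            record { consts = consts ; tabs = tabs ; d+r = advance d+r ; cols≡ = cols≡ ; hs = hs
                   ; gs = extend (sym (m≤n⇒m⊔n≡n (≮⇒≥ g≮i))) ; i≡ = h≡ }

        stop : ∀ s → Inv 0 s → ¬ Holds (less rD rCols) s
        stop s I h = <⇒≢ h (trans (full (Inv.d+r I)) (sym (Inv.cols≡ I)))

        correct : ∀ s → Consts Z s → Tables s → reg s rCols ≡ N → Entries N (arr s aH) (R j) →
                  Reaches inp majority-step s (3 + N * 8) (λ s′ → Entries N (arr s′ aG) (S (suc j)))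
        correct s C T N≡ hs =
          let t , s′ , ρ , t≤ , J = while-rule Inv body stop N (eval (clear rI) (eval (clear rD) s))
                (record { consts = C ; tabs = T ; d+r = refl ; cols≡ = N≡ ; hs = hs ; gs = λ _ () ; i≡ = refl })
          in _ , s′ , (basic ⨾ basic ⨾ ρ) , s≤s (s≤s t≤) ,
          subst (λ k → Entries k (arr s′ aG) (S (suc j))) (full (Inv.d+r J)) (Inv.gs J)

      module Columns (N : ℕ) where

        -- The second component keeps the last entry of the row at hand. In row `p` it is nonzero
        -- exactly when `δ < N`, by monotonicity, and so it serves as the test of the doubling loop.
        Row : ℕ → St → Set
        Row j s = Entries N (arr s aH) (R j) × (∀ d → N ≡ suc d → reg s rH ≡ R j d)

        record StartInv (r : ℕ) (s : St) : Set where
          field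
            consts : Consts Z s
            d+r    : reg s rD + r ≡ N
            cols≡  : reg s rCols ≡ N
            gs     : Entries (reg s rD) (arr s aG) (S 0)
            next≡  : reg s rNext ≡ reg s rD + reg s rD

        start-body : ∀ r s → StartInv (suc r) s → Holds (less rD rCols) s × Reaches inp startBody s 4 (StartInv r)
        start-body r s I = subst (reg s rD <_) (sym cols≡) (not-full d+r) ,
          _ , _ , (basic ⨾ basic ⨾ basic ⨾ basic) , ≤-refl ,
          record { consts = consts ; d+r = advance d+r ; cols≡ = cols≡
                 ; gs = add-entry (arr s aG) (S 0) (Constants.n₁≡ consts) gs
                 ; next≡ = cong suc (trans (cong suc next≡) (sym (+-suc (reg s rD) (reg s rD)))) }
          where open StartInv I

        start-stop : ∀ s → StartInv 0 s → ¬ Holds (less rD rCols) s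
        start-stop s I h = <⇒≢ h (trans (full (StartInv.d+r I)) (sym (StartInv.cols≡ I)))

        record Inv (r : ℕ) (s : St) : Set where
          field
            consts : Consts Z s
            tabs   : Tables s
            j+r    : reg s rJ + r ≡ p
            cols≡  : reg s rCols ≡ N
            row    : Row (reg s rJ) s

        row-cost : ℕ
        row-cost = 1 + ((3 + N * 8) + (4 + N * 19))

        body : ∀ r s → Inv (suc r) s → Holds (less rJ rP) s × Reaches inp rowBody s row-cost (Inv r)
        body r s I = subst (reg s rJ <_) (sym (TableValues.p≡ tabs)) (not-full j+r) , go
          where
          open Inv I
          s₁ : St
          s₁ = eval (incr rJ rJ) s
          go : Reaches inp rowBody s row-cost (Inv r)
          go =
            let t₂ , s₂ , ρ₂ , t₂≤ , gs = MajorityStep.correct (reg s rJ) N s₁ consts tabs cols≡ (proj₁ row)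
                consts₂ = keep-consts ρ₂ (refl ∷ refl ∷ refl ∷ refl ∷ refl ∷ refl ∷ []) consts
                tabs₂ = keep-tables ρ₂ (refl ∷ refl ∷ refl ∷ refl ∷ []) refl tabs
                cols₂ = trans (frame-reg ρ₂ rCols refl) cols≡
                t₃ , s₃ , ρ₃ , t₃≤ , row₃ =
                  Minority.correct (suc (reg s rJ)) N s₂ consts₂ tabs₂ (frame-reg ρ₂ rJ refl) cols₂ gs
                j≡ = trans (frame-reg ρ₃ rJ refl) (frame-reg ρ₂ rJ refl)
            in _ , s₃ , (basic ⨾ ρ₂ ⨾ ρ₃) , s≤s (+-mono-≤ t₂≤ t₃≤) ,
            record { consts = keep-consts ρ₃ (refl ∷ refl ∷ refl ∷ refl ∷ refl ∷ refl ∷ []) consts₂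
                   ; tabs = keep-tables ρ₃ (refl ∷ refl ∷ refl ∷ refl ∷ []) refl tabs₂
                   ; j+r = trans (cong (_+ r) j≡) (advance j+r)
                   ; cols≡ = trans (frame-reg ρ₃ rCols refl) cols₂
                   ; row = subst (λ j → Row j s₃) (sym j≡) row₃ }

        stop : ∀ s → Inv 0 s → ¬ Holds (less rJ rP) s
        stop s I h = <⇒≢ h (trans (full (Inv.j+r I)) (sym (TableValues.p≡ (Inv.tabs I))))

        cost : ℕ
        cost = 3 + (suc (N * 5) + (1 + ((4 + N * 19) + suc (p * suc row-cost))))

        correct : ∀ s → Consts Z s → Tables s → reg s rNext ≡ N →
                  Reaches inp columns s cost (λ s′ → Row p s′ × reg s′ rNext ≡ N + N)
        correct s C T next≡ =
          let t₁ , s₁ , ρ₁ , t₁≤ , J₁ = while-rule StartInv start-body start-stop N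
                (eval (clear rD) (eval (clear rNext) (eval (copy rCols rNext) s)))
                (record { consts = C ; d+r = refl ; cols≡ = next≡ ; gs = λ _ () ; next≡ = refl })
              d≡N = full (StartInv.d+r J₁)
              tabs₁ = keep-tables ρ₁ (refl ∷ refl ∷ refl ∷ refl ∷ []) refl T
              t₂ , s₂ , ρ₂ , t₂≤ , row₂ = Minority.correct 0 N (eval (clear rJ) s₁) (StartInv.consts J₁) tabs₁
                refl (StartInv.cols≡ J₁) (subst (λ k → Entries k (arr s₁ aG) (S 0)) d≡N (StartInv.gs J₁))
              t₃ , s₃ , ρ₃ , t₃≤ , J₃ = while-rule Inv body stop p s₂
                 (record { consts = keep-consts ρ₂ (refl ∷ refl ∷ refl ∷ refl ∷ refl ∷ refl ∷ []) (StartInv.consts J₁)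
                         ; tabs = keep-tables ρ₂ (refl ∷ refl ∷ refl ∷ refl ∷ []) refl tabs₁
                         ; j+r = cong (_+ p) (frame-reg ρ₂ rJ refl)
                         ; cols≡ = trans (frame-reg ρ₂ rCols refl) (StartInv.cols≡ J₁)
                         ; row = subst (λ j → Row j s₂) (sym (frame-reg ρ₂ rJ refl)) row₂ })
          in _ , s₃ , (basic ⨾ basic ⨾ basic ⨾ ρ₁ ⨾ basic ⨾ ρ₂ ⨾ ρ₃) ,
          s≤s (s≤s (s≤s (+-mono-≤ t₁≤ (s≤s (+-mono-≤ t₂≤ t₃≤))))) ,
          subst (λ j → Row j s₃) (full (Inv.j+r J₃)) (Inv.row J₃) ,
          trans (frame-reg ρ₃ rNext refl) (trans (frame-reg ρ₂ rNext refl)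
            (trans (StartInv.next≡ J₁) (cong₂ _+_ d≡N d≡N)))

      private
        -- The 36 is the cost of one row with a single column, loop test included; the term added in
        -- the proof is the exact slack.
        columns-cost : ∀ k → suc (Columns.cost (suc k)) ≤ suc k * (suc p * 36)
        columns-cost k = ≤-trans (m≤m+n _ (1 + 12 * k + 9 * (k * p))) (≤-reflexive (identity k p))
          where
          identity : ∀ k p →
            1 + (3 + (1 + (1 + k) * 5 + (1 + ((4 + (1 + k) * 19) + (1 + p * (1 + (1 + ((3 + (1 + k) * 8) + (4 + (1 + k) * 19)))))))))
            + (1 + 12 * k + 9 * (k * p)) ≡ (1 + k) * ((1 + p) * 36)
          identity = solve-∀

      module Doubling (δ : ℕ) (possible : 0 < R p δ) (least : ∀ d → d < δ → R p d ≡ 0) where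

        Finished : St → Set
        Finished s = ∃[ N ] (δ < N × Entries N (arr s aH) (R p))

        -- `X` is a budget of columns. A pass over `N` columns spends `N` of it while `N` doubles,
        -- so `N + X` is constant. As a pass is repeated only if `N ≤ δ`, `N` never exceeds
        -- `2 δ + 1`, and the budget always covers the next pass. `fuel` ensures termination, since
        -- `N` grows in each repetition.
        correct : ∀ fuel k X s → suc k + X ≡ 4 * δ + 2 → suc k ≤ 2 * δ + 1 → 2 * δ + 1 < suc k + fuel →
                  Consts Z s → Tables s → reg s rNext ≡ suc k → reg s rH ≡ 0 →
                  Reaches inp (while (equal rH rZero) columns) s (suc (X * (suc p * 36))) Finished
        correct zero k X s budget N≤ fuel< C T next≡ h≡ =
          contradiction (subst (2 * δ + 1 <_) (+-identityʳ (suc k)) fuel<) (≤⇒≯ N≤)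
        correct (suc fuel) k X s budget N≤ fuel< C T next≡ h≡ =
          continue (Columns.correct (suc k) s C T next≡)
          where
          N = suc k
          holds : reg s rH ≡ reg s rZero
          holds = trans h≡ (sym (Constants.zero≡ C))
          N+N≤ : N + N ≤ N + X
          N+N≤ = ≤-trans (+-mono-≤ N≤ N≤) (≤-reflexive (trans (twice δ) (sym budget)))
            where
            twice : ∀ δ → (2 * δ + 1) + (2 * δ + 1) ≡ 4 * δ + 2
            twice = solve-∀
          N≤X : N ≤ X
          N≤X = +-cancelˡ-≤ N N X N+N≤
          continue : Reaches inp columns s (Columns.cost N) (λ s′ → Columns.Row N p s′ × reg s′ rNext ≡ N + N) →
                     Reaches inp (while (equal rH rZero) columns) s (suc (X * (suc p * 36))) Finished
          continue (t , s′ , ρ , t≤ , (hs , last≡) , next′) with R p k ≟ 0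
          ... | no R≢0 = _ , s′ ,
            loop holds ρ (exit λ h → R≢0 (trans (sym (last≡ k refl)) (trans h
              (trans (frame-reg ρ rZero refl) (Constants.zero≡ C))))) ,
            s≤s (≤-trans (≤-reflexive (+-comm t 1)) (≤-trans (s≤s t≤) (≤-trans (columns-cost k)
              (*-monoˡ-≤ (suc p * 36) N≤X)))) ,
            N , s≤s (≮⇒≥ (λ k<δ → R≢0 (least k k<δ))) , hs
          ... | yes R≡0 = recurse (correct fuel (k + N) (X ∸ N) s′
              (trans (+-assoc N N (X ∸ N)) (trans (cong (N +_) (m+[n∸m]≡n N≤X)) budget))
              (≤-trans (+-mono-≤ k<δ k<δ) (≤-trans (≤-reflexive (cong (δ +_) (sym (+-identityʳ δ)))) (m≤m+n (2 * δ) 1)))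
              (≤-trans fuel< (≤-trans (≤-reflexive (cong (N +_) (+-comm 1 fuel)))
                (≤-trans (+-monoʳ-≤ N (≤-trans (+-monoʳ-≤ fuel (s≤s (z≤n {k}))) (≤-reflexive (+-comm fuel N))))
                  (≤-reflexive (sym (+-assoc N N fuel))))))
              (keep-consts ρ (refl ∷ refl ∷ refl ∷ refl ∷ refl ∷ refl ∷ []) C)
              (keep-tables ρ (refl ∷ refl ∷ refl ∷ refl ∷ []) refl T)
              next′ (trans (last≡ k refl) R≡0))
            where
            k<δ : k < δ
            k<δ = ≰⇒> λ δ≤k → <⇒≱ possible (≤-trans (reach-mono isZ n (runs len p) δ≤k) (≤-reflexive R≡0))
            recurse : Reaches inp (while (equal rH rZero) columns) s′ (suc ((X ∸ N) * (suc p * 36))) Finished →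
                      Reaches inp (while (equal rH rZero) columns) s (suc (X * (suc p * 36))) Finished
            recurse (t′ , s″ , ρ′ , t′≤ , fin) = _ , s″ , loop holds ρ ρ′ ,
              ≤-trans (+-mono-≤ (≤-trans (s≤s t≤) (columns-cost k)) t′≤)
                (≤-trans (≤-reflexive (+-suc (N * (suc p * 36)) _))
                  (s≤s (≤-reflexive (trans (sym (*-distribʳ-+ (suc p * 36) N (X ∸ N)))
                    (cong (_* (suc p * 36)) (m+[n∸m]≡n N≤X)))))) ,
              fin

        record SearchInv (r : ℕ) (s : St) : Set where
          field
            consts : Consts Z s
            d+r    : reg s rD + r ≡ δ
            h≡     : reg s rH ≡ R p (reg s rD)
            done   : ∃[ N ] (δ < N × Entries N (arr s aH) (R p))

        search-body : ∀ r s → SearchInv (suc r) s →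
                      Holds (equal rH rZero) s × Reaches inp searchBody s 2 (SearchInv r)
        search-body r s I = trans h≡ (trans (least (reg s rD) d<δ) (sym (Constants.zero≡ consts))) ,
          _ , _ , (basic ⨾ basic) , ≤-refl ,
          record { consts = consts ; d+r = advance d+r ; done = done
                 ; h≡ = proj₂ (proj₂ done) _ (≤-<-trans d<δ (proj₁ (proj₂ done))) }
          where
          open SearchInv I
          d<δ = not-full d+r

        search-stop : ∀ s → SearchInv 0 s → ¬ Holds (equal rH rZero) s
        search-stop s I h = <⇒≢ possible (sym (trans (cong (R p) (sym (full (SearchInv.d+r I))))
          (trans (sym (SearchInv.h≡ I)) (trans h (Constants.zero≡ (SearchInv.consts I))))))

        search-correct : ∀ s → Consts Z s → Finished s →
                         Reaches inp search s (4 + δ * 3) (λ s′ → reg s′ rT ≡ m ∸ δ)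
        search-correct s C fin@(N , δ<N , hs) =
          let t , s′ , ρ , t≤ , J = while-rule SearchInv search-body search-stop δ
                (eval (get rH aH rD) (eval (clear rD) s))
                (record { consts = C ; d+r = refl ; done = fin ; h≡ = hs 0 (≤-<-trans z≤n δ<N) })
          in _ , _ , (basic ⨾ basic ⨾ ρ ⨾ basic) ,
             s≤s (s≤s (≤-trans (+-monoˡ-≤ 1 t≤) (≤-reflexive (+-comm (suc (δ * 3)) 1)))) ,
             cong₂ _∸_ (Constants.m≡ (SearchInv.consts J)) (full (SearchInv.d+r J))

  -- Assembly of the phases.

  time-bound : ℕ → ℕ → ℕ
  time-bound p δ = (6 + n * 6) + ((3 + suc n * 8) + ((3 + suc n * 7) + ((2 + m * 8) +
    (2 + (suc ((4 * δ + 1) * (suc p * 36)) + (4 + δ * 3))))))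

  record Result (s : St) : Set where
    field
      p δ time   : ℕ
      final      : St
      run        : Run inp lcs-code s time final
      time≤      : time ≤ time-bound p δ
      δ≤m        : δ ≤ m
      p≤m        : p ≤ m
      few        : p * n ≤ 2 * #matchingPairs xs ys
      output≡    : reg final rT ≡ m ∸ δ
      longest    : LCSLength xs ys (m ∸ δ)

  lcs-code-correct : ∀ s → Initial s → Result s
  lcs-code-correct s₀ init = afterMajority (Majority.correct s₀ init)
    where
    afterMajority : Reaches inp majority s₀ (6 + n * 6) (λ s′ → ∃[ Z ] (Consts Z s′ × n ≤ 2 * count Z xs)) → Result s₀
    afterMajority (t₁ , s₁ , ρ₁ , t₁≤ , Z , C₁ , half) =
      afterRanks (Ranks.correct s₁ C₁ (λ A i → trans (cong (λ f → f i) (frame-arr ρ₁ A (untouched A))) (Initial.arr≡ init A i)))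
      where
      open WithMajority Z
      untouched : ∀ A → writesArr majority A ≡ false
      untouched _ = refl
      afterRanks : Reaches inp ranks s₁ (3 + suc n * 8) (λ s′ → RankTable (arr s′ aRank) × KthTable (arr s′ aKth)) → Result s₀
      afterRanks (t₂ , s₂ , ρ₂ , t₂≤ , ranks₂ , kths₂) = afterPrevs (Prevs.correct s₂ C₂
          (λ i → trans (cong (λ f → f i) (trans (frame-arr ρ₂ aPrev refl) (frame-arr ρ₁ aPrev refl))) (Initial.arr≡ init aPrev i)))
        where
        C₂ = keep-consts ρ₂ (refl ∷ refl ∷ refl ∷ refl ∷ refl ∷ refl ∷ []) C₁
        afterPrevs : Reaches inp prevs-table s₂ (3 + suc n * 7) (λ s′ → PrevTable (arr s′ aPrev)) → Result s₀
        afterPrevs (t₃ , s₃ , ρ₃ , t₃≤ , prevs₃) = afterRuns (Runs.correct s₃ C₃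
            (trans (frame-reg ρ₃ rP refl) (trans (frame-reg ρ₂ rP refl) (trans (frame-reg ρ₁ rP refl) (Initial.p≡ init))))
            (λ i → trans (cong (λ f → f i) (trans (frame-arr ρ₃ aLen refl) (trans (frame-arr ρ₂ aLen refl) (frame-arr ρ₁ aLen refl))))
                         (Initial.arr≡ init aLen i)))
          where
          C₃ = keep-consts ρ₃ (refl ∷ refl ∷ refl ∷ refl ∷ refl ∷ refl ∷ []) C₂
          afterRuns : Reaches inp run-table s₃ (2 + m * 8) (λ s′ → RunTable (arr s′ aLen) (reg s′ rP) ys) → Result s₀
          afterRuns (t₄ , s₄ , ρ₄ , t₄≤ , runs≡ , p≡) = afterLoop
              (D.correct (2 * δ + 1) 0 (4 * δ + 1) s₅ (sym (+-suc (4 * δ) 1)) (m≤n+m 1 (2 * δ)) ≤-refl C₄ T₄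
                (Constants.one≡ C₄) refl)
            where
            C₄ = keep-consts ρ₄ (refl ∷ refl ∷ refl ∷ refl ∷ refl ∷ refl ∷ []) C₃
            p = reg s₄ rP
            len = arr s₄ aLen
            open Rows p len
            open Reach xs Z isZ reads using (deletions; deletions⇒LCS; Deletions)
            s₅ : St
            s₅ = eval (copy rNext rOne) (eval (clear rH) s₄)
            T₄ : Tables s₄
            T₄ = tables
              (subst RankTable (sym (trans (frame-arr ρ₄ aRank refl) (frame-arr ρ₃ aRank refl))) ranks₂)
              (subst KthTable (sym (trans (frame-arr ρ₄ aKth refl) (frame-arr ρ₃ aKth refl))) kths₂)
              (subst PrevTable (sym (frame-arr ρ₄ aPrev refl)) prevs₃)
              (λ _ → refl) refl
            δ = proj₁ (deletions ys)
            del : Deletions ys δ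
            del = proj₂ (deletions ys)
            module D = Doubling δ (subst (λ zs → 0 < reach isZ n zs δ) runs≡ (proj₁ (proj₂ del)))
                                  (λ d d<δ → trans (cong (λ zs → reach isZ n zs d) (sym runs≡)) (proj₂ (proj₂ del) d d<δ))
            afterLoop : Reaches inp (while (equal rH rZero) columns) s₅ (suc ((4 * δ + 1) * (suc p * 36))) D.Finished → Result s₀
            afterLoop (t₆ , s₆ , ρ₆ , t₆≤ , fin) = afterSearch (D.search-correct s₆ C₆ fin)
              where
              C₆ = keep-consts ρ₆ (refl ∷ refl ∷ refl ∷ refl ∷ refl ∷ refl ∷ []) C₄
              afterSearch : Reaches inp search s₆ (4 + δ * 3) (λ s′ → reg s′ rT ≡ m ∸ δ) → Result s₀
              afterSearch (t₇ , s₇ , ρ₇ , t₇≤ , out) = record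
                { p = p ; δ = δ ; final = s₇
                ; run = ρ₁ ⨾ ρ₂ ⨾ ρ₃ ⨾ ρ₄ ⨾ basic ⨾ basic ⨾ ρ₆ ⨾ ρ₇
                ; time≤ = +-mono-≤ t₁≤ (+-mono-≤ t₂≤ (+-mono-≤ t₃≤ (+-mono-≤ t₄≤ (s≤s (s≤s (+-mono-≤ t₆≤ t₇≤))))))
                ; δ≤m = proj₁ del
                ; p≤m = ≤-trans (≤-reflexive p≡) (length-filter (_≟ᶠ Z) ys)
                ; few = ≤-trans (*-monoʳ-≤ p half) (≤-trans (≤-reflexive
                    (trans (cong (_* (2 * count Z xs)) p≡) (rearrange (count Z ys) (count Z xs))))
                    (*-monoʳ-≤ 2 (count*count≤matching Z xs ys)))
                ; output≡ = out
                ; longest = deletions⇒LCS ys del }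
                where
                rearrange : ∀ a b → a * (2 * b) ≡ 2 * (b * a)
                rearrange = solve-∀

-- Execution on the word RAM

prologue epilogue : List (Instr (3 + #regs))
prologue =
  -- All registers start at 0, so the first load already addresses the cell of the length of x.
  load (⇑ rN) scratch₀ ∷ loadConst scratch₀ 1 ∷ load (⇑ rM) scratch₀ ∷
  op add origin (⇑ rN) (⇑ rM) ∷ loadConst scratch₀ 2 ∷ op add origin origin scratch₀ ∷ []
epilogue = loadConst scratch₀ 0 ∷ store scratch₀ (⇑ rT) ∷ []

lcs-instructions : List (Instr (3 + #regs))
lcs-instructions = prologue ++ (compile lcs-code 6 ++ epilogue)

lcs-program : Program
lcs-program = record { #registers = 3 + #regs ; code = lcs-instructions }

fetch-length : ∀ {k} (is : List (Instr k)) → fetch is (length is) ≡ nothing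
fetch-length []       = refl
fetch-length (i ∷ is) = fetch-length is

halts : ∀ {k a} (is : List (Instr (3 + k))) (c : Cmd k a) i j →
        fetch (is ++ (compile c (length is) ++ i ∷ j ∷ [])) (2 + end c (length is)) ≡ nothing
halts is c i j = trans (cong (fetch (is ++ (compile c (length is) ++ i ∷ j ∷ []))) (sym total)) (fetch-length (is ++ (compile c (length is) ++ i ∷ j ∷ [])))
  where
  open ≡-Reasoning
  total : length (is ++ (compile c (length is) ++ i ∷ j ∷ [])) ≡ 2 + end c (length is)
  total = begin
    length (is ++ (compile c (length is) ++ i ∷ j ∷ []))       ≡⟨ length-++ is ⟩
    length is + length (compile c (length is) ++ i ∷ j ∷ [])   ≡⟨ cong (length is +_) (length-++ (compile c (length is))) ⟩
    length is + (length (compile c (length is)) + 2)           ≡⟨ +-comm (length is) _ ⟩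
    length (compile c (length is)) + 2 + length is             ≡⟨ cong (_+ length is) (+-comm _ 2) ⟩
    2 + (length (compile c (length is)) + length is)           ≡⟨ cong (2 +_) (length-compile c (length is)) ⟩
    2 + end c (length is) ∎

set≤ : ∀ {k B} (ρ : Vector ℕ k) d {v} → v ≤ B → (∀ r → ρ r ≤ B) → ∀ r → set ρ d v r ≤ B
set≤ {B = B} ρ d {v} v≤ ρ≤ r with r ≟ᶠ d
... | yes refl = subst (_≤ B) (sym (updateAt-updates r ρ)) v≤
... | no r≢d   = subst (_≤ B) (sym (updateAt-minimal r d ρ r≢d)) (ρ≤ r)

cell≤1 : ∀ (xs ys : BinString) i → cell (map toℕ xs ++ map toℕ ys) i ≤ 1
cell≤1 (zero ∷ xs)     ys zero    = z≤n
cell≤1 (suc zero ∷ xs) ys zero    = ≤-refl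
cell≤1 (_ ∷ xs)        ys (suc i) = cell≤1 xs ys i
cell≤1 [] []              i       = z≤n
cell≤1 [] (zero ∷ ys)     zero    = z≤n
cell≤1 [] (suc zero ∷ ys) zero    = ≤-refl
cell≤1 [] (_ ∷ ys)        (suc i) = cell≤1 [] ys i

cell-beyond : ∀ us i → length us ≤ i → cell us i ≡ 0
cell-beyond []       i       _        = refl
cell-beyond (u ∷ us) (suc i) (s≤s l≤) = cell-beyond us i l≤

n<2^bits : ∀ n → n < 2 ^ bits n
n<2^bits n = ≰⇒> λ 2^≤n → 1+n≰n (≤-trans (≤-reflexive (sym (⌊log₂[2^n]⌋≡n (bits n)))) (⌊log₂⌋-mono-≤ 2^≤n))

-- Two factors `2 ^ b` dominate `n * n`, and as `b ≥ 1` fourteen more dominate `2 ^ 14`: this is the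
-- origin of the constant 16.
word-size : ∀ n b w → n < 2 ^ b → 1 ≤ b → 16 * b ≤ w → n * n * 2 ^ 14 < 2 ^ w
word-size n b w n< 1≤b b≤ = <-≤-trans (*-monoˡ-< (2 ^ 14) (*-mono-< n< n<))
  (≤-trans (*-monoʳ-≤ (B * B) (^-monoˡ-≤ 14 (^-monoʳ-≤ 2 1≤b))) (≤-trans (≤-reflexive power) (^-monoʳ-≤ 2 b≤)))
  where
  B = 2 ^ b
  power : B * B * B ^ 14 ≡ 2 ^ (16 * b)
  power = begin
    B * B * B ^ 14 ≡⟨ *-assoc B B (B ^ 14) ⟩
    B ^ 16         ≡⟨ ^-*-assoc 2 b 16 ⟩
    2 ^ (b * 16)   ≡⟨ cong (2 ^_) (*-comm b 16) ⟩
    2 ^ (16 * b) ∎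
    where open ≡-Reasoning

start : BinString → BinString → State #regs #arrs
start xs ys = state (set (set (λ _ → 0) rN (length xs)) rM (length ys)) (λ _ _ → 0)

start-initial : ∀ xs ys → Correctness.Initial xs ys (start xs ys)
start-initial xs ys = record
  { reg-n = refl ; reg-m = refl ; zero≡ = refl ; c₀≡ = refl ; c₁≡ = refl ; p≡ = refl ; arr≡ = λ _ _ → refl }

lcs-halts : fetch lcs-instructions (2 + end lcs-code 6) ≡ nothing
lcs-halts = halts prologue lcs-code (loadConst scratch₀ 0) (store scratch₀ (⇑ rT))

module Execution (xs ys : BinString) (m≤n : length ys ≤ length xs) (1≤n : 1 ≤ length xs)
                 (result : Correctness.Result xs ys (start xs ys)) where

  open Correctness xs ys
  open Result result

  -- Each of 1, `m`, `δ` and `p` is at most `n`, so the linear terms collapse to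
  -- `284 = 72 + 21 + 8 + 147 + 36`.
  time-linear : time ≤ n * 284 + δ * p * 144
  time-linear = ≤-trans time≤ (≤-trans (≤-reflexive (expand n m p δ)) (≤-trans
    (+-monoˡ-≤ (δ * p * 144) (+-mono-≤ (+-mono-≤ (+-mono-≤ (+-monoˡ-≤ (n * 21) (*-monoˡ-≤ 72 1≤n))
      (*-monoˡ-≤ 8 m≤n)) (*-monoˡ-≤ 147 (≤-trans δ≤m m≤n))) (*-monoˡ-≤ 36 (≤-trans p≤m m≤n))))
    (≤-reflexive (collect n (δ * p)))))
    where
    expand : ∀ n m p δ →
      (6 + n * 6) + ((3 + (1 + n) * 8) + ((3 + (1 + n) * 7) + ((2 + m * 8) +
        (2 + ((1 + (4 * δ + 1) * ((1 + p) * 36)) + (4 + δ * 3)))))) ≡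
      1 * 72 + n * 21 + m * 8 + δ * 147 + p * 36 + δ * p * 144
    expand = solve-∀
    collect : ∀ n a → n * 72 + n * 21 + n * 8 + n * 147 + n * 36 + a * 144 ≡ n * 284 + a * 144
    collect = solve-∀

  n≤n² : n ≤ n * n
  n≤n² = ≤-trans (≤-reflexive (sym (*-identityʳ n))) (*-monoʳ-≤ n 1≤n)

  -- `suc n` bounds every input number and `time` the growth after it; the factor 4 is `2 ^ 2`, for
  -- the highest level.
  U X off : ℕ
  U = suc n + time
  X = 4 * U
  off = n + m + 2

  U≤ : U ≤ n * n * 430
  U≤ = ≤-trans (+-mono-≤ (s≤s (≤-refl {n})) time-linear) (≤-trans
    (+-mono-≤ (+-mono-≤ (≤-trans 1≤n n≤n²) n≤n²)
      (+-mono-≤ (*-monoˡ-≤ 284 n≤n²) (*-monoˡ-≤ 144 (*-mono-≤ (≤-trans δ≤m m≤n) (≤-trans p≤m m≤n)))))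
    (≤-reflexive (collect (n * n))))
    where
    collect : ∀ a → a + a + (a * 284 + a * 144) ≡ a * 430
    collect = solve-∀

  -- `U` is at most `430 n²` and is used `4 * 7` times, giving 12040; the seven arrays and the
  -- offset add `7 + 1 + 1 + 2 = 11`.
  footprint : X * #arrs + (#arrs + off) ≤ n * n * 2 ^ 14
  footprint = ≤-trans (+-mono-≤ space rest) (≤-trans (≤-reflexive (sym (*-distribˡ-+ (n * n) 12040 11)))
    (*-monoʳ-≤ (n * n) (≤ᵇ⇒≤ 12051 (2 ^ 14) tt)))
    where
    1≤n² = ≤-trans 1≤n n≤n²
    regroup : ∀ u → 4 * u * 7 ≡ u * 28
    regroup = solve-∀
    space : X * #arrs ≤ n * n * 12040
    space = ≤-trans (≤-reflexive (regroup U)) (≤-trans (*-monoˡ-≤ 28 U≤) (≤-reflexive (*-assoc (n * n) 430 28)))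
    collect : ∀ a → a * 7 + (a + a + a * 2) ≡ a * 11
    collect = solve-∀
    rest : #arrs + off ≤ n * n * 11
    rest = ≤-trans (+-mono-≤ (*-monoˡ-≤ 7 1≤n²) (+-mono-≤ (+-mono-≤ n≤n² (≤-trans m≤n n≤n²)) (*-monoˡ-≤ 2 1≤n²)))
                   (≤-reflexive (collect (n * n)))

  module OnWords (w : ℕ) (wide : 16 * bits n ≤ w) where

    room : X * #arrs + (#arrs + off) < 2 ^ w
    room = ≤-<-trans footprint (word-size n (bits n) w (n<2^bits n) (s≤s z≤n) wide)

    X<2^w : suc X < 2 ^ w
    X<2^w = ≤-<-trans (≤-trans (≤-reflexive (+-comm 1 X)) (+-mono-≤ (m≤m*n X #arrs) (s≤s z≤n))) room

    level≤ : ∀ r → 2 ^ level r * U ≤ X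
    level≤ r = *-monoˡ-≤ U (^-monoʳ-≤ 2 (level≤2 r))
      where
      level≤2 : ∀ r → level r ≤ 2
      level≤2 zero                                   = s≤s z≤n
      level≤2 (suc zero)                             = s≤s z≤n
      level≤2 (suc (suc zero))                       = s≤s z≤n
      level≤2 (suc (suc (suc zero)))                 = ≤-refl
      level≤2 (suc (suc (suc (suc _))))              = z≤n

    length-inp≡off : length inp ≡ off
    length-inp≡off = trans length-inp (+-comm 2 (n + m))

    open Levels level using (bounded)
    open Simulation {#regs} {#arrs} level w lcs-instructions inp off X U (≤-reflexive length-inp≡off) X<2^w room level≤

    σ₀ : Config (3 + #regs) w
    σ₀ = initial (3 + #regs) w xs ys

    off<2^w : off < 2 ^ w
    off<2^w = ≤-<-trans (≤-trans (m≤n+m off #arrs) (m≤n+m (#arrs + off) (X * #arrs))) room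

    inp≤ : ∀ i → cell inp i ≤ suc n
    inp≤ zero          = n≤1+n n
    inp≤ (suc zero)    = m≤n⇒m≤1+n m≤n
    inp≤ (suc (suc i)) = ≤-trans (cell≤1 xs ys i) (s≤s z≤n)

    memory₀ : ∀ a → a < 2 ^ w → toℕ (memory σ₀ (toWord w a)) ≡ cell inp a
    memory₀ a a< = trans (toℕ-toWord w (≤-<-trans (inp≤ (toℕ (toWord w a))) 1+n<)) (cong (cell inp) (toℕ-toWord w a<))
      where
      1+n< : suc n < 2 ^ w
      1+n< = <-trans (s≤s (≤-trans (m≤m+n (suc n) time) (m≤m+n U (3 * U)))) X<2^w

    2<2^w : 2 < 2 ^ w
    2<2^w = ≤-<-trans (m≤n+m 2 (n + m)) off<2^w

    r₆ : Vector (Word w) (3 + #regs)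
    r₆ = registers (exec {w = w} (op add origin origin scratch₀) (exec (loadConst scratch₀ 2)
      (exec (op add origin (⇑ rN) (⇑ rM)) (exec (load (⇑ rM) scratch₀) (exec (loadConst scratch₀ 1)
        (exec (load (⇑ rN) scratch₀) σ₀))))))

    start-sim : Sim (start xs ys) r₆ (memory σ₀)
    start-sim = record
      { registers = toℕ-updateAt _ _ rM n-m (toℕ-updateAt _ _ rN n-n (λ _ → zero-word))
      ; base = trans (toℕ-toWord w (subst (_< 2 ^ w) (sym sum₂) off<2^w)) sum₂
      ; input = λ i i< → memory₀ i (<-trans (subst (i <_) length-inp≡off i<) off<2^w)
      -- The memory behind the input is initially 0, in agreement with the arrays of `start`.
      ; arrays = λ A i a< → trans (memory₀ _ a<)
          (cell-beyond inp _ (≤-trans (≤-reflexive length-inp≡off) (m≤n+m off (i * #arrs + toℕ A))))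
      }
      where
      zero-word : toℕ (toWord w 0) ≡ 0
      zero-word = toℕ-toWord w (<-trans (s≤s z≤n) 2<2^w)
      n-n = memory₀ 0 (<-trans (s≤s z≤n) 2<2^w)
      n-m = memory₀ 1 (<-trans (s≤s (s≤s z≤n)) 2<2^w)
      sum = cong₂ _+_ n-n n-m
      sum₁ = trans (toℕ-toWord w (subst (_< 2 ^ w) (sym sum) (≤-<-trans (m≤m+n (n + m) 2) off<2^w))) sum
      sum₂ = cong₂ _+_ sum₁ (toℕ-toWord w 2<2^w)

    start-bounded : Levels.Bounded level (suc n) (start xs ys)
    start-bounded = bounded (λ r → ≤-trans (≤n r) (scale r)) (λ _ _ → z≤n)
      where
      ≤n : ∀ r → reg (start xs ys) r ≤ suc n
      ≤n = set≤ (set (λ _ → 0) rN n) rM (m≤n⇒m≤1+n m≤n) (set≤ (λ _ → 0) rN (n≤1+n n) (λ _ → z≤n))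
      scale : ∀ r → suc n ≤ 2 ^ level r * suc n
      scale r = subst (_≤ 2 ^ level r * suc n) (*-identityˡ (suc n)) (*-monoˡ-≤ (suc n) (m^n>0 2 (level r)))

    located : At lcs-instructions 6 (compile lcs-code 6) × At lcs-instructions (end lcs-code 6) epilogue
    located = At-compile lcs-code (At-offset prologue (compile lcs-code 6 ++ epilogue))

    starting : ∀ {t} {τ : Config (3 + #regs) w} → lcs-program ⊢ config 6 r₆ (memory σ₀) ⇓[ t ] τ → lcs-program ⊢ σ₀ ⇓[ 6 + t ] τ
    starting h = step refl (step refl (step refl (step refl (step refl (step refl h)))))

    finishing : ∀ {q} {r : Vector (Word w) (3 + #regs)} {m : Vector (Word w) (2 ^ w)} →
      At lcs-instructions q epilogue → fetch lcs-instructions (2 + q) ≡ nothing →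
      _⊢_⇓[_]_ {w} lcs-program (config q r m) 2
        (config (2 + q) (updateAt r scratch₀ (const (toWord w 0))) (updateAt m (toWord w 0) (const (r (⇑ rT)))))
    finishing (f₀ ∷ f₁ ∷ []) stop = step f₀ (step f₁ (halted stop))

    simulated : Simulates 6 (end lcs-code 6) (6 * time) final r₆ (memory σ₀)
    simulated = simulate run lcs-code-levelled start-bounded inp≤ ≤-refl (proj₁ located) start-sim

    outputs : ∃[ t ] (t ≤ 8 + 6 * time × Outputs lcs-program w xs ys t (m ∸ δ))
    outputs =
      let t , r , μ , t≤ , S , h = simulated in
      6 + (t + 2) ,
      +-monoʳ-≤ 6 (≤-trans (≤-reflexive (+-comm t 2)) (+-monoʳ-≤ 2 t≤)) ,
      config (2 + end lcs-code 6) (updateAt r scratch₀ (const (toWord w 0)))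
             (updateAt μ (toWord w 0) (const (r (⇑ rT)))) ,
      starting (h (finishing {r = r} {μ} (proj₂ located) lcs-halts)) ,
      trans (cong toℕ (updateAt-updates (toWord w 0) μ)) (trans (Sim.registers S rT) output≡)

  -- Multiplying by `n` creates the product `p n`, which `few` replaces by `2 M`. The `δ M` term
  -- then has coefficient `144 * 6 * 2 = 1728`, and the quadratic one `8 + 284 * 6 = 1712`, where 8
  -- counts prologue and epilogue.
  time-total : ∀ {t} K → 1728 ≤ K → t ≤ 8 + 6 * time →
               t * n ≤ K * (n * n + (m ∸ (m ∸ δ)) * #matchingPairs xs ys)
  time-total {t} K ≤K t≤ = begin
    t * n ≤⟨ *-monoˡ-≤ n t≤ ⟩
    (8 + 6 * time) * n ≤⟨ *-monoˡ-≤ n (+-mono-≤ (*-monoˡ-≤ 8 1≤n) (*-monoʳ-≤ 6 time-linear)) ⟩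
    (n * 8 + 6 * (n * 284 + δ * p * 144)) * n ≡⟨ collect n δ p 8 284 144 ⟩
    n * n * (8 + 284 * 6) + δ * (p * n) * (144 * 6)
      ≤⟨ +-monoʳ-≤ (n * n * (8 + 284 * 6)) (*-monoˡ-≤ (144 * 6) (*-monoʳ-≤ δ few)) ⟩
    n * n * (8 + 284 * 6) + δ * (2 * M) * (144 * 6) ≡⟨ cong (n * n * (8 + 284 * 6) +_) (regroup δ M (144 * 6)) ⟩
    n * n * (8 + 284 * 6) + δ * M * (144 * 6 * 2)
      ≤⟨ +-mono-≤ (*-monoʳ-≤ (n * n) (≤-trans (≤ᵇ⇒≤ 1712 1728 tt) ≤K)) (*-monoʳ-≤ (δ * M) ≤K) ⟩
    n * n * K + δ * M * K ≡⟨ *-distribʳ-+ K (n * n) (δ * M) ⟨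
    (n * n + δ * M) * K ≡⟨ *-comm (n * n + δ * M) K ⟩
    K * (n * n + δ * M) ≡⟨ cong (λ d → K * (n * n + d * M)) (m∸[m∸n]≡n δ≤m) ⟨
    K * (n * n + (m ∸ (m ∸ δ)) * M) ∎
    where
    open ≤-Reasoning
    M = #matchingPairs xs ys
    collect : ∀ n δ p a b c →
      (n * a + 6 * (n * b + δ * p * c)) * n ≡ n * n * (a + b * 6) + δ * (p * n) * (c * 6)
    collect = solve-∀
    regroup : ∀ δ M c → δ * (2 * M) * c ≡ δ * M * (c * 2)
    regroup = solve-∀

  conclusion : ∀ w K → 1728 ≤ K → 16 * bits (length xs) ≤ w → ∃[ L ] ∃[ t ]
    ( LCSLength xs ys L
    × Outputs lcs-program w xs ys t L
    × t * length xs ≤ K * (length xs * length xs + (length ys ∸ L) * #matchingPairs xs ys) )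
  conclusion w K ≤K wide =
    let t , t≤ , out = OnWords.outputs w wide in m ∸ δ , t , longest , out , time-total K ≤K t≤

theorem3p5 : ∃[ P ] ∃[ c ] ∀ (d : ℕ) → ∃[ C ]
    ∀ (w : ℕ) (x y : BinString) →
    length x ≥ length y → length x ≥ 1 →
    c * bits (length x) ≤ w → w ≤ d * bits (length x) →
    ∃[ L ] ∃[ t ]
    ( LCSLength x y L
    × Outputs P w x y t L
    × t * length x ≤ C * (length x * length x + (length y ∸ L) * #matchingPairs x y) )
theorem3p5 = lcs-program , 16 , λ d → 1728 , λ w x y m≤n 1≤n wide _ →
  Execution.conclusion x y m≤n 1≤n (Correctness.lcs-code-correct x y (start x y) (start-initial x y)) w 1728 ≤-refl wide
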